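{- Let $I(x)$ be the independence polynomial of $\varGamma(\mathbb{Z}_{p^2q})$, where $p<q$ are primes. Then all complex zeros of $I(x)$ different from $x=-1$ lie in the annular region $$\left\{x\in\mathbb{C}:\frac12<|1+x|<2\right\}.$$
   Context: For a positive integer $n$, the zero divisor graph $\varGamma(\mathbb{Z}_n)$ is the simple undirected graph whose vertices are the non-zero zero divisors of the ring $\mathbb{Z}_n$ of integers modulo $n$ (non-zero $a$ such that $ab=0$ for some non-zero $b$), two distinct vertices $a,b$ being adjacent if and only if $ab=0$ in $\mathbb{Z}_n$. An independent set of a finite graph $G$ is a set of vertices no two of which are adjacent (the empty set included); $\alpha(G)$ is the maximum size of an independent set, and $s_k(G)$ is the number of independent sets of size $k$. The independence polynomial of $G$ is $I(G,x)=\sum_{k=0}^{\alpha(G)} s_k(G)x^k$. -}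

module Defs where

open import Data.Nat as ℕ using (ℕ; zero; suc)
import Data.Nat.Properties as ℕₚ
open import Data.Nat.DivMod using (_mod_)
open import Data.Nat.Primality using (Prime; prime⇒nonZero)
open import Data.Integer as ℤ using (+_)
import Data.Integer.Properties as ℤₚ
open import Data.Rational
  using (ℚ; mkℚ; 0ℚ; 1ℚ; ½; _/_; ↥_; toℚᵘ; _<_; _≤_; *≤*; *<*; 1/_; _+_; _*_; _-_; -_; ∣_∣;
          positive; nonNegative)
open import Data.Rational.Properties
  using (_≤?_; ≰⇒>; ≮⇒≥; <⇒≤; ≤-refl; ≤-trans; ≤-reflexive; <-≤-trans; ≤-<-trans; <-irrefl; _<?_;
          +-mono-<; +-mono-≤; +-mono-<-≤; +-monoʳ-≤; +-monoˡ-≤; +-monoʳ-<; +-identityʳ; +-identityˡ;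
          +-inverseʳ; *-identityˡ; *-identityʳ; *-zeroˡ; *-inverseʳ; *-distribʳ-+;
          *-monoʳ-≤-nonNeg; *-monoˡ-≤-nonNeg; *-monoˡ-<-pos; *-monoʳ-<-pos; pos*pos⇒pos; 1/pos⇒pos;
          pos⇒nonZero; positive⁻¹; ∣p+q∣≤∣p∣+∣q∣; ∣p*q∣≡∣p∣*∣q∣; ∣-p∣≡∣p∣; 0≤∣p∣; ∣p∣≡p∨∣p∣≡-p;
          0≤p⇒∣p∣≡p; toℚᵘ-injective; toℚᵘ-homo-+; toℚᵘ-homo-*; toℚᵘ-fromℚᵘ; toℚᵘ-cancel-≤;
          toℚᵘ-cancel-<; module ≤-Reasoning)
import Data.Rational.Unnormalised as ℚᵘ
import Data.Rational.Unnormalised.Properties as ℚᵘₚ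
open import Data.Rational.Solver using (module +-*-Solver)
open import Data.Empty using (⊥-elim)
open import Data.Fin as Fin using (Fin; toℕ)
open import Data.Fin.Properties using (any?; all?)
open import Data.Fin.Subset using (Subset; inside; outside; _∈_) renaming (∣_∣ to card)
open import Data.Fin.Subset.Properties using (_∈?_)
open import Data.List using (List; []; _∷_; _++_; map; filter; foldr; length; applyUpTo)
open import Data.Vec using ([]; _∷_)
open import Data.Product using (_×_; _,_; ∃-syntax)
open import Data.Sum using (_⊎_; inj₁; inj₂)
open import Level using (0ℓ)
open import Relation.Binary using (Rel; Decidable; Symmetric; Irreflexive)
open import Relation.Unary using (Pred)
import Relation.Unary as U
open import Relation.Nullary using (yes; no; ¬_)
open import Relation.Nullary.Decidable using (_×-dec_; _→-dec_; ¬?)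
open import Relation.Binary.PropositionalEquality
  using (_≡_; _≢_; refl; sym; trans; cong; cong₂; subst; subst₂; module ≡-Reasoning)

-- The vertices are those elements of Fin bound that satisfy IsVertex;
-- Adj is only ever consulted on vertices.
record Graph : Set₁ where
  field
    bound      : ℕ
    IsVertex   : Pred (Fin bound) 0ℓ
    isVertex?  : U.Decidable IsVertex
    Adj        : Rel (Fin bound) 0ℓ
    adj?       : Decidable Adj
    adj-sym    : Symmetric Adj
    adj-irrefl : Irreflexive _≡_ Adj

module _ (G : Graph) where
  open Graph G

  Independent : Pred (Subset bound) 0ℓ
  Independent S = (∀ v → v ∈ S → IsVertex v)
                × (∀ u v → u ∈ S → v ∈ S → ¬ Adj u v)

  independent? : U.Decidable Independent
  independent? S =
    all? (λ v → (v ∈? S) →-dec isVertex? v)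
    ×-dec
    all? (λ u → all? (λ v → (u ∈? S) →-dec ((v ∈? S) →-dec ¬? (adj? u v))))

allSubsets : ∀ n → List (Subset n)
allSubsets zero    = [] ∷ []
allSubsets (suc n) = map (outside ∷_) (allSubsets n) ++ map (inside ∷_) (allSubsets n)

independentSets : (G : Graph) → List (Subset (Graph.bound G))
independentSets G = filter (independent? G) (allSubsets (Graph.bound G))

α : Graph → ℕ
α G = foldr ℕ._⊔_ 0 (map card (independentSets G))

s : ℕ → Graph → ℕ
s k G = length (filter (λ S → card S ℕ.≟ k) (independentSets G))

-- Coefficient lists, constant term first.
Polynomial : Set
Polynomial = List ℕ

independencePolynomial : Graph → Polynomial
independencePolynomial G = applyUpTo (λ k → s k G) (suc (α G))

-- ℤₙ is Fin n, with multiplication modulo n.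
module _ (n : ℕ) .{{_ : ℕ.NonZero n}} where

  0ₙ : Fin n
  0ₙ = 0 mod n

  infixl 7 _*ₙ_
  _*ₙ_ : Fin n → Fin n → Fin n
  a *ₙ b = (toℕ a ℕ.* toℕ b) mod n

  NonzeroZeroDivisor : Pred (Fin n) 0ℓ
  NonzeroZeroDivisor a = a ≢ 0ₙ × ∃[ b ] (b ≢ 0ₙ × a *ₙ b ≡ 0ₙ)

  zeroDivisorGraph : Graph
  zeroDivisorGraph = record
    { bound      = n
    ; IsVertex   = NonzeroZeroDivisor
    ; isVertex?  = λ a → ¬? (a Fin.≟ 0ₙ) ×-dec
                         any? (λ b → ¬? (b Fin.≟ 0ₙ) ×-dec (a *ₙ b Fin.≟ 0ₙ))
    ; Adj        = λ a b → a ≢ b × a *ₙ b ≡ 0ₙ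
    ; adj?       = λ a b → ¬? (a Fin.≟ b) ×-dec (a *ₙ b Fin.≟ 0ₙ)
    ; adj-sym    = λ {a} {b} (a≢b , ab≡0) →
                     (λ b≡a → a≢b (sym b≡a)) ,
                     trans (cong (_mod n) (ℕₚ.*-comm (toℕ b) (toℕ a))) ab≡0
    ; adj-irrefl = λ a≡b (a≢b , _) → a≢b a≡b
    }

p²q-nonZero : ∀ {p q} → Prime p → Prime q → ℕ.NonZero (p ℕ.^ 2 ℕ.* q)
p²q-nonZero {p} {q} pp pq =
  ℕₚ.m*n≢0 (p ℕ.^ 2) q {{ℕₚ.m^n≢0 p 2 {{prime⇒nonZero pp}}}} {{prime⇒nonZero pq}}

fromℕ : ℕ → ℚ
fromℕ k = + k / 1

toℚᵘ-/ : ∀ k d → toℚᵘ (+ k / suc d) ℚᵘ.≃ ℚᵘ.mkℚᵘ (+ k) d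
toℚᵘ-/ k d = toℚᵘ-fromℚᵘ (ℚᵘ.mkℚᵘ (+ k) d)

0<½ : 0ℚ < ½
0<½ = positive⁻¹ ½

*-pos : ∀ {p q} → 0ℚ < p → 0ℚ < q → 0ℚ < p * q
*-pos {p} {q} 0<p 0<q =
  positive⁻¹ (p * q) {{pos*pos⇒pos p {{positive 0<p}} q {{positive 0<q}}}}

+-nonNeg : ∀ p q → 0ℚ ≤ p → 0ℚ ≤ q → 0ℚ ≤ p + q
+-nonNeg p q 0≤p 0≤q = +-mono-≤ {0ℚ} {p} {0ℚ} {q} 0≤p 0≤q

half+half : ∀ ε → ½ * ε + ½ * ε ≡ ε
half+half ε = trans (sym (*-distribʳ-+ ε ½ ½)) (*-identityˡ ε)

square-mono : ∀ {p q} → 0ℚ ≤ p → p ≤ q → p * p ≤ q * q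
square-mono {p} {q} 0≤p p≤q = ≤-trans
  (*-monoʳ-≤-nonNeg p {{nonNegative 0≤p}} p≤q)
  (*-monoˡ-≤-nonNeg q {{nonNegative (≤-trans 0≤p p≤q)}} p≤q)

neg-swap : ∀ a b → - (a - b) ≡ b - a
neg-swap = solve 2 (λ a b → :- (a :- b) := b :- a) refl
  where open +-*-Solver

∣-∣< : ∀ a b {ε} → a - b < ε → b - a < ε → ∣ a - b ∣ < ε
∣-∣< a b {ε} h k with ∣p∣≡p∨∣p∣≡-p (a - b)
... | inj₁ e = subst (_< ε) (sym e) h
... | inj₂ e = subst (_< ε) (sym (trans e (neg-swap a b))) k

≤∣∣ : ∀ p → p ≤ ∣ p ∣
≤∣∣ p with 0ℚ ≤? p
... | yes 0≤p = ≤-reflexive (sym (0≤p⇒∣p∣≡p 0≤p))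
... | no  0≰p = ≤-trans (<⇒≤ (≰⇒> 0≰p)) (0≤∣p∣ p)

Cauchy : (ℕ → ℚ) → Set
Cauchy x = ∀ ε → 0ℚ < ε → ∃[ N ] (∀ m n → N ℕ.≤ m → N ℕ.≤ n → ∣ x m - x n ∣ < ε)

-- The standard library has no real numbers. A real is a Cauchy sequence of rationals
-- carrying its modulus of convergence; _≈ℝ_ is the equality, and _<ℝ_ asks for a
-- rational gap ε that eventually separates the two sequences.
record ℝ : Set where
  constructor mkℝ
  field
    seq    : ℕ → ℚ
    cauchy : Cauchy seq
open ℝ public

infix 4 _≈ℝ_ _<ℝ_

_≈ℝ_ : Rel ℝ 0ℓ
x ≈ℝ y = ∀ ε → 0ℚ < ε → ∃[ N ] (∀ n → N ℕ.≤ n → ∣ seq x n - seq y n ∣ < ε)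

_<ℝ_ : Rel ℝ 0ℓ
x <ℝ y = ∃[ ε ] (0ℚ < ε × ∃[ N ] (∀ n → N ℕ.≤ n → seq x n + ε ≤ seq y n))

fromℚ : ℚ → ℝ
fromℚ q = mkℝ (λ _ → q) λ ε 0<ε → 0 , λ _ _ _ _ →
  subst (λ d → ∣ d ∣ < ε) (sym (+-inverseʳ q)) 0<ε

infixl 6 _+ℝ_
infix  8 -ℝ_
infixl 7 _*ℝ_

_+ℝ_ : ℝ → ℝ → ℝ
x +ℝ y = mkℝ (λ n → seq x n + seq y n) +-cauchy
  where
  regroup : ∀ a b c d → (a + b) - (c + d) ≡ (a - c) + (b - d)
  regroup = solve 4 (λ a b c d → (a :+ b) :- (c :+ d) := (a :- c) :+ (b :- d)) refl
    where open +-*-Solver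

  +-cauchy : Cauchy (λ n → seq x n + seq y n)
  +-cauchy ε 0<ε with cauchy x (½ * ε) (*-pos 0<½ 0<ε) | cauchy y (½ * ε) (*-pos 0<½ 0<ε)
  ... | M , hM | N , hN = M ℕ.⊔ N , λ m n M≤m M≤n → begin-strict
    ∣ (seq x m + seq y m) - (seq x n + seq y n) ∣
      ≡⟨ cong ∣_∣ (regroup (seq x m) (seq y m) (seq x n) (seq y n)) ⟩
    ∣ (seq x m - seq x n) + (seq y m - seq y n) ∣
      ≤⟨ ∣p+q∣≤∣p∣+∣q∣ (seq x m - seq x n) (seq y m - seq y n) ⟩
    ∣ seq x m - seq x n ∣ + ∣ seq y m - seq y n ∣
      <⟨ +-mono-< (hM m n (ℕₚ.m⊔n≤o⇒m≤o M N M≤m) (ℕₚ.m⊔n≤o⇒m≤o M N M≤n))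
                  (hN m n (ℕₚ.m⊔n≤o⇒n≤o M N M≤m) (ℕₚ.m⊔n≤o⇒n≤o M N M≤n)) ⟩
    ½ * ε + ½ * ε
      ≡⟨ half+half ε ⟩
    ε ∎
    where open ≤-Reasoning

-ℝ_ : ℝ → ℝ
-ℝ x = mkℝ (λ n → - seq x n) λ ε 0<ε → let N , h = cauchy x ε 0<ε in
  N , λ m n N≤m N≤n → subst (_< ε)
    (trans (sym (∣-p∣≡∣p∣ (seq x m - seq x n))) (cong ∣_∣ (neg-sub (seq x m) (seq x n))))
    (h m n N≤m N≤n)
  where
  neg-sub : ∀ a b → - (a - b) ≡ (- a) - (- b)
  neg-sub = solve 2 (λ a b → :- (a :- b) := (:- a) :- (:- b)) refl
    where open +-*-Solver

eventuallyBounded : ∀ x → ∃[ B ] (0ℚ < B × ∃[ N ] (∀ n → N ℕ.≤ n → ∣ seq x n ∣ ≤ B))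
eventuallyBounded x with cauchy x 1ℚ (positive⁻¹ 1ℚ)
... | N , h = 1ℚ + ∣ seq x N ∣ , +-mono-<-≤ (positive⁻¹ 1ℚ) (0≤∣p∣ (seq x N)) ,
  N , λ n N≤n → begin
    ∣ seq x n ∣                          ≡⟨ cong ∣_∣ (split (seq x n) (seq x N)) ⟩
    ∣ (seq x n - seq x N) + seq x N ∣    ≤⟨ ∣p+q∣≤∣p∣+∣q∣ (seq x n - seq x N) (seq x N) ⟩
    ∣ seq x n - seq x N ∣ + ∣ seq x N ∣  ≤⟨ +-monoˡ-≤ ∣ seq x N ∣ (<⇒≤ (h n N N≤n ℕₚ.≤-refl)) ⟩
    1ℚ + ∣ seq x N ∣                     ∎
  where
  open ≤-Reasoning
  split : ∀ a b → a ≡ (a - b) + b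
  split = solve 2 (λ a b → a := (a :- b) :+ b) refl
    where open +-*-Solver

reciprocal : ∀ B → 0ℚ < B → ∃[ η ] (0ℚ < η × B * η ≡ 1ℚ)
reciprocal B 0<B = 1/ B , positive⁻¹ (1/ B) {{1/pos⇒pos B}} , *-inverseʳ B
  where
  instance
    B-positive = positive 0<B
    B-nonZero  = pos⇒nonZero B

*-close : ∀ {B₁ B₂ κ} a b c d → 0ℚ < B₁ → 0ℚ < B₂ → ∣ a ∣ ≤ B₁ → ∣ d ∣ ≤ B₂ →
          ∣ a - c ∣ < κ → ∣ b - d ∣ < κ → ∣ a * b - c * d ∣ < B₁ * κ + κ * B₂
*-close {B₁} {B₂} {κ} a b c d 0<B₁ 0<B₂ a≤ d≤ ac bd = begin-strict
  ∣ a * b - c * d ∣                          ≡⟨ cong ∣_∣ (regroup a b c d) ⟩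
  ∣ a * (b - d) + (a - c) * d ∣              ≤⟨ ∣p+q∣≤∣p∣+∣q∣ (a * (b - d)) ((a - c) * d) ⟩
  ∣ a * (b - d) ∣ + ∣ (a - c) * d ∣
    ≡⟨ cong₂ _+_ (∣p*q∣≡∣p∣*∣q∣ a (b - d)) (∣p*q∣≡∣p∣*∣q∣ (a - c) d) ⟩
  ∣ a ∣ * ∣ b - d ∣ + ∣ a - c ∣ * ∣ d ∣
    ≤⟨ +-mono-≤ (*-monoʳ-≤-nonNeg ∣ b - d ∣ {{nonNegative (0≤∣p∣ (b - d))}} a≤)
                (*-monoˡ-≤-nonNeg ∣ a - c ∣ {{nonNegative (0≤∣p∣ (a - c))}} d≤) ⟩
  B₁ * ∣ b - d ∣ + ∣ a - c ∣ * B₂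
    <⟨ +-mono-< (*-monoʳ-<-pos B₁ {{positive 0<B₁}} bd)
                (*-monoˡ-<-pos B₂ {{positive 0<B₂}} ac) ⟩
  B₁ * κ + κ * B₂                            ∎
  where
  open ≤-Reasoning
  regroup : ∀ a b c d → a * b - c * d ≡ a * (b - d) + (a - c) * d
  regroup = solve 4 (λ a b c d → a :* b :- c :* d := a :* (b :- d) :+ (a :- c) :* d) refl
    where open +-*-Solver

scale : ∀ B₁ B₂ η ε → (B₁ + B₂) * η ≡ 1ℚ → B₁ * (η * ε) + (η * ε) * B₂ ≡ ε
scale B₁ B₂ η ε e = trans (factor B₁ B₂ η ε) (trans (cong (_* ε) e) (*-identityˡ ε))
  where
  factor : ∀ b c h e → b * (h * e) + (h * e) * c ≡ ((b + c) * h) * e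
  factor = solve 4 (λ b c h e → b :* (h :* e) :+ (h :* e) :* c := ((b :+ c) :* h) :* e) refl
    where open +-*-Solver

_*ℝ_ : ℝ → ℝ → ℝ
x *ℝ y = mkℝ (λ n → seq x n * seq y n) *-cauchy
  where
  *-cauchy : Cauchy (λ n → seq x n * seq y n)
  *-cauchy ε 0<ε =
    let B₁ , 0<B₁ , M₁ , b₁ = eventuallyBounded x
        B₂ , 0<B₂ , M₂ , b₂ = eventuallyBounded y
        η , 0<η , Bη≡1 = reciprocal (B₁ + B₂) (+-mono-< 0<B₁ 0<B₂)
        N₁ , h₁ = cauchy x (η * ε) (*-pos 0<η 0<ε)
        N₂ , h₂ = cauchy y (η * ε) (*-pos 0<η 0<ε)
        M = M₁ ℕ.⊔ M₂
        N = N₁ ℕ.⊔ N₂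
    in M ℕ.⊔ N , λ m n L≤m L≤n →
      let M≤m = ℕₚ.m⊔n≤o⇒m≤o M N L≤m
          N≤m = ℕₚ.m⊔n≤o⇒n≤o M N L≤m
          M≤n = ℕₚ.m⊔n≤o⇒m≤o M N L≤n
          N≤n = ℕₚ.m⊔n≤o⇒n≤o M N L≤n
      in subst (∣ seq x m * seq y m - seq x n * seq y n ∣ <_) (scale B₁ B₂ η ε Bη≡1)
           (*-close (seq x m) (seq y m) (seq x n) (seq y n) 0<B₁ 0<B₂
             (b₁ m (ℕₚ.m⊔n≤o⇒m≤o M₁ M₂ M≤m)) (b₂ n (ℕₚ.m⊔n≤o⇒n≤o M₁ M₂ M≤n))
             (h₁ m n (ℕₚ.m⊔n≤o⇒m≤o N₁ N₂ N≤m) (ℕₚ.m⊔n≤o⇒m≤o N₁ N₂ N≤n))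
             (h₂ m n (ℕₚ.m⊔n≤o⇒n≤o N₁ N₂ N≤m) (ℕₚ.m⊔n≤o⇒n≤o N₁ N₂ N≤n)))

-- The largest r among 0, δ, …, kδ with r = 0 or r² ≤ q.
gridRoot : ℕ → ℚ → ℚ → ℚ
gridRoot zero    δ q = 0ℚ
gridRoot (suc k) δ q with gridRoot k δ q
... | r with (r + δ) * (r + δ) ≤? q
...   | yes _ = r + δ
...   | no  _ = r

mesh : ℕ → ℚ
mesh n = + 1 / suc n

-- With this size the grid reaches up to 1 + ∣ numerator of q ∣, which exceeds √q.
gridSize : ℕ → ℚ → ℕ
gridSize n q = suc n ℕ.* suc ℤ.∣ ↥ q ∣

-- Approximates √(max(q,0)) from below with error less than 1/(n+1).
-- (Matching on record{} stops √approx from unfolding on open terms.)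
√approx : ℕ → ℚ → ℚ
√approx n q@record{} = gridRoot (gridSize n q) (mesh n) q

gridRoot-nonNeg : ∀ k {δ} q → 0ℚ < δ → 0ℚ ≤ gridRoot k δ q
gridRoot-nonNeg zero q 0<δ = ≤-refl
gridRoot-nonNeg (suc k) {δ} q 0<δ with gridRoot k δ q | gridRoot-nonNeg k q 0<δ
... | r | 0≤r with (r + δ) * (r + δ) ≤? q
...   | yes _ = +-nonNeg r δ 0≤r (<⇒≤ 0<δ)
...   | no  _ = 0≤r

gridRoot-below : ∀ k δ q → gridRoot k δ q ≡ 0ℚ ⊎ gridRoot k δ q * gridRoot k δ q ≤ q
gridRoot-below zero δ q = inj₁ refl
gridRoot-below (suc k) δ q with gridRoot k δ q | gridRoot-below k δ q
... | r | h with (r + δ) * (r + δ) ≤? q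
...   | yes p = inj₂ p
...   | no  _ = h

fromℕ-suc : ∀ k → fromℕ (suc k) ≡ fromℕ k + 1ℚ
fromℕ-suc k = toℚᵘ-injective (ℚᵘₚ.≃-trans (toℚᵘ-/ (suc k) 0) (ℚᵘₚ.≃-sym
  (ℚᵘₚ.≃-trans (toℚᵘ-homo-+ (fromℕ k) 1ℚ)
  (ℚᵘₚ.≃-trans (ℚᵘₚ.+-cong (toℚᵘ-/ k 0) (ℚᵘₚ.≃-refl {ℚᵘ.1ℚᵘ}))
  (ℚᵘ.*≡* (cong (ℤ._* + 1) (trans (cong (ℤ._+ + 1) (ℤₚ.*-identityʳ (+ k))) (cong +_ (ℕₚ.+-comm k 1)))))))))

fromℕ-* : ∀ a b → fromℕ (a ℕ.* b) ≡ fromℕ a * fromℕ b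
fromℕ-* a b = toℚᵘ-injective (ℚᵘₚ.≃-trans (toℚᵘ-/ (a ℕ.* b) 0) (ℚᵘₚ.≃-sym
  (ℚᵘₚ.≃-trans (toℚᵘ-homo-* (fromℕ a) (fromℕ b))
  (ℚᵘₚ.≃-trans (ℚᵘₚ.*-cong (toℚᵘ-/ a 0) (toℚᵘ-/ b 0))
  (ℚᵘ.*≡* (cong (ℤ._* + 1) (sym (ℤₚ.pos-* a b))))))))

mesh-inverse : ∀ n → fromℕ (suc n) * mesh n ≡ 1ℚ
mesh-inverse n = toℚᵘ-injective
  (ℚᵘₚ.≃-trans (toℚᵘ-homo-* (fromℕ (suc n)) (mesh n))
  (ℚᵘₚ.≃-trans (ℚᵘₚ.*-cong (toℚᵘ-/ (suc n) 0) (toℚᵘ-/ 1 n))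
  (ℚᵘ.*≡* (cong +_ (trans (ℕₚ.*-identityʳ _) (trans (ℕₚ.*-identityʳ (suc n))
     (sym (trans (ℕₚ.+-identityʳ _) (ℕₚ.+-identityʳ (suc n))))))))))

0<mesh : ∀ n → 0ℚ < mesh n
0<mesh n = toℚᵘ-cancel-< (ℚᵘₚ.<-respʳ-≃ (ℚᵘₚ.≃-sym (toℚᵘ-/ 1 n))
  (ℚᵘₚ.positive⁻¹ (ℚᵘ.mkℚᵘ (+ 1) n)))

≤-numerator : ∀ q → q ≤ fromℕ ℤ.∣ ↥ q ∣
≤-numerator (mkℚ (+ k) d c) = toℚᵘ-cancel-≤ (ℚᵘₚ.≤-respʳ-≃ (ℚᵘₚ.≃-sym (toℚᵘ-/ k 0))
  (ℚᵘ.*≤* (subst₂ ℤ._≤_ (ℤₚ.pos-* k 1) (ℤₚ.pos-* k (suc d))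
    (ℤ.+≤+ (ℕₚ.*-monoʳ-≤ k (ℕ.s≤s ℕ.z≤n))))))
≤-numerator (mkℚ (ℤ.-[1+ k ]) d c) = toℚᵘ-cancel-≤ (ℚᵘₚ.≤-respʳ-≃ (ℚᵘₚ.≃-sym (toℚᵘ-/ (suc k) 0))
  (ℚᵘ.*≤* ℤ.-≤+))

0≤fromℕ : ∀ k → 0ℚ ≤ fromℕ k
0≤fromℕ zero = ≤-refl
0≤fromℕ (suc k) = subst (0ℚ ≤_) (sym (fromℕ-suc k)) (+-nonNeg (fromℕ k) 1ℚ (0≤fromℕ k) (<⇒≤ (positive⁻¹ 1ℚ)))

gridRoot-above : ∀ k δ q →
  gridRoot k δ q ≡ fromℕ k * δ ⊎ q < (gridRoot k δ q + δ) * (gridRoot k δ q + δ)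
gridRoot-above zero δ q = inj₁ (sym (*-zeroˡ δ))
gridRoot-above (suc k) δ q with gridRoot k δ q | gridRoot-above k δ q
... | r | h with (r + δ) * (r + δ) ≤? q
...   | no  r≰ = inj₂ (≰⇒> r≰)
...   | yes r≤ with h
...     | inj₂ q< = ⊥-elim (<-irrefl refl (<-≤-trans q< r≤))
...     | inj₁ refl = inj₁ (trans (step (fromℕ k) δ) (cong (_* δ) (sym (fromℕ-suc k))))
  where
  step : ∀ a δ → a * δ + δ ≡ (a + 1ℚ) * δ
  step = solve 2 (λ a d → a :* d :+ d := (a :+ con 1ℚ) :* d) refl
    where open +-*-Solver

√approx-nonNeg : ∀ n q → 0ℚ ≤ √approx n q
√approx-nonNeg n q@record{} = gridRoot-nonNeg (gridSize n q) q (0<mesh n)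

√approx-below : ∀ n q → √approx n q ≡ 0ℚ ⊎ √approx n q * √approx n q ≤ q
√approx-below n q@record{} = gridRoot-below (gridSize n q) (mesh n) q

gridRoot-far : ∀ K δ q k → 0ℚ < δ → 0ℚ ≤ k → q ≤ k → fromℕ K * δ ≡ k + 1ℚ →
               q < (gridRoot K δ q + δ) * (gridRoot K δ q + δ)
gridRoot-far K δ q k 0<δ 0≤k q≤k reach with gridRoot K δ q | gridRoot-above K δ q
... | r | inj₂ h = h
... | r | inj₁ e = begin-strict
  q                     ≤⟨ q≤k ⟩
  k                     ≡⟨ sym (+-identityʳ k) ⟩
  k + 0ℚ                <⟨ +-monoʳ-< k (positive⁻¹ 1ℚ) ⟩
  k + 1ℚ                ≡⟨ sym (*-identityˡ (k + 1ℚ)) ⟩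
  1ℚ * (k + 1ℚ)         ≤⟨ *-monoʳ-≤-nonNeg (k + 1ℚ) {{nonNegative 0≤k+1}} 1≤k+1 ⟩
  (k + 1ℚ) * (k + 1ℚ)   ≤⟨ square-mono 0≤k+1 k+1≤r+δ ⟩
  (r + δ) * (r + δ)     ∎
  where
  open ≤-Reasoning
  0≤1 : 0ℚ ≤ 1ℚ
  0≤1 = <⇒≤ (positive⁻¹ 1ℚ)
  1≤k+1 : 1ℚ ≤ k + 1ℚ
  1≤k+1 = subst (_≤ k + 1ℚ) (+-identityˡ 1ℚ) (+-monoˡ-≤ 1ℚ 0≤k)
  0≤k+1 : 0ℚ ≤ k + 1ℚ
  0≤k+1 = ≤-trans 0≤1 1≤k+1
  k+1≤r+δ : k + 1ℚ ≤ r + δ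
  k+1≤r+δ = subst₂ _≤_ (+-identityʳ (k + 1ℚ)) (cong (_+ δ) (sym (trans e reach)))
    (+-monoʳ-≤ (k + 1ℚ) (<⇒≤ 0<δ))

mesh-reach : ∀ n k → fromℕ (suc n ℕ.* suc k) * mesh n ≡ fromℕ k + 1ℚ
mesh-reach n k = begin
  fromℕ (suc n ℕ.* suc k) * mesh n          ≡⟨ cong (_* mesh n) (fromℕ-* (suc n) (suc k)) ⟩
  fromℕ (suc n) * fromℕ (suc k) * mesh n    ≡⟨ swap (fromℕ (suc n)) (fromℕ (suc k)) (mesh n) ⟩
  fromℕ (suc n) * mesh n * fromℕ (suc k)    ≡⟨ cong (_* fromℕ (suc k)) (mesh-inverse n) ⟩
  1ℚ * fromℕ (suc k)                        ≡⟨ *-identityˡ (fromℕ (suc k)) ⟩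
  fromℕ (suc k)                             ≡⟨ fromℕ-suc k ⟩
  fromℕ k + 1ℚ                              ∎
  where
  open ≡-Reasoning
  swap : ∀ a b c → a * b * c ≡ a * c * b
  swap = solve 3 (λ a b c → a :* b :* c := a :* c :* b) refl
    where open +-*-Solver

√approx-above : ∀ n q → q < (√approx n q + mesh n) * (√approx n q + mesh n)
√approx-above n q@record{} =
  gridRoot-far (gridSize n q) (mesh n) q (fromℕ ℤ.∣ ↥ q ∣)
    (0<mesh n) (0≤fromℕ ℤ.∣ ↥ q ∣) (≤-numerator q) (mesh-reach n ℤ.∣ ↥ q ∣)

archimedean : ∀ ε → 0ℚ < ε → ∃[ N ] (∀ n → N ℕ.≤ n → mesh n ≤ ε)
archimedean (mkℚ (+ zero) d c) (*<* (ℤ.+<+ ()))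
archimedean (mkℚ ℤ.+[1+ k ] d c) _ = d , λ n d≤n →
  toℚᵘ-cancel-≤ (ℚᵘₚ.≤-respˡ-≃ (ℚᵘₚ.≃-sym (toℚᵘ-/ 1 n))
    (ℚᵘ.*≤* (ℤ.+≤+ (ℕₚ.*-mono-≤ (ℕ.s≤s (ℕ.z≤n {k})) (ℕ.s≤s d≤n)))))
archimedean (mkℚ ℤ.-[1+ k ] d c) (*<* ())

¾ : ℚ
¾ = + 3 / 4

√-step : ∀ r r' δ u t ε → 0ℚ < ε → 0ℚ ≤ r → 0ℚ ≤ δ → δ ≤ ½ * ε →
         u < (r + δ) * (r + δ) → r' ≡ 0ℚ ⊎ r' * r' ≤ t →
         t - u < ¾ * (ε * ε) → r' - r < ε
√-step r r' δ u t ε 0<ε 0≤r 0≤δ δ≤ u< below close with r' - r <? ε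
... | yes h = h
... | no  h = ⊥-elim (<-irrefl refl (<-≤-trans t<r'² (r'²≤t below)))
  where
  open ≤-Reasoning
  shift : ∀ a b → (a - b) + b ≡ a
  shift = solve 2 (λ a b → (a :- b) :+ b := a) refl
    where open +-*-Solver
  0≤ε+r : 0ℚ ≤ ε + r
  0≤ε+r = +-nonNeg ε r (<⇒≤ 0<ε) 0≤r
  ε+r≤r' : ε + r ≤ r'
  ε+r≤r' = subst (ε + r ≤_) (shift r' r) (+-monoˡ-≤ r (≮⇒≥ h))
  0<r' : 0ℚ < r'
  0<r' = <-≤-trans (subst (_< ε + r) (+-identityˡ 0ℚ) (+-mono-<-≤ 0<ε 0≤r)) ε+r≤r'
  r'²≤t : r' ≡ 0ℚ ⊎ r' * r' ≤ t → r' * r' ≤ t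
  r'²≤t (inj₁ e) = ⊥-elim (<-irrefl (sym e) 0<r')
  r'²≤t (inj₂ h) = h
  expand : ∀ r ε → ¾ * (ε * ε) + (r + ½ * ε) * (r + ½ * ε) + ε * r ≡ (ε + r) * (ε + r)
  expand = solve 2 (λ r e → con ¾ :* (e :* e) :+ (r :+ con ½ :* e) :* (r :+ con ½ :* e) :+ e :* r
                            := (e :+ r) :* (e :+ r)) refl
    where open +-*-Solver
  0≤εr : 0ℚ ≤ ε * r
  0≤εr = subst (_≤ ε * r) (*-zeroˡ r) (*-monoʳ-≤-nonNeg r {{nonNegative 0≤r}} (<⇒≤ 0<ε))
  A B : ℚ
  A = ¾ * (ε * ε)
  B = (r + ½ * ε) * (r + ½ * ε)
  t<r'² : t < r' * r'
  t<r'² = begin-strict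
    t                        ≡⟨ sym (shift t u) ⟩
    (t - u) + u              <⟨ +-mono-< close u< ⟩
    A + (r + δ) * (r + δ)    ≤⟨ +-monoʳ-≤ A (square-mono (+-nonNeg r δ 0≤r 0≤δ) (+-monoʳ-≤ r δ≤)) ⟩
    A + B                    ≡⟨ sym (+-identityʳ (A + B)) ⟩
    A + B + 0ℚ               ≤⟨ +-monoʳ-≤ (A + B) 0≤εr ⟩
    A + B + ε * r            ≡⟨ expand r ε ⟩
    (ε + r) * (ε + r)        ≤⟨ square-mono 0≤ε+r ε+r≤r' ⟩
    r' * r'                  ∎

√approx-step : ∀ m n u t ε → 0ℚ < ε → mesh m ≤ ½ * ε → t - u < ¾ * (ε * ε) →
               √approx n t - √approx m u < ε
√approx-step m n u t ε 0<ε mesh≤ close =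
  √-step (√approx m u) (√approx n t) (mesh m) u t ε 0<ε (√approx-nonNeg m u)
    (<⇒≤ (0<mesh m)) mesh≤ (√approx-above m u) (√approx-below n t) close

-- √ x is the square root of max(x,0).
√_ : ℝ → ℝ
√ x = mkℝ (λ n → √approx n (seq x n)) √-cauchy
  where
  √-cauchy : Cauchy (λ n → √approx n (seq x n))
  √-cauchy ε 0<ε with cauchy x (¾ * (ε * ε)) (*-pos (positive⁻¹ ¾) (*-pos 0<ε 0<ε))
                    | archimedean (½ * ε) (*-pos 0<½ 0<ε)
  ... | M , hM | N , hN = M ℕ.⊔ N , λ m n L≤m L≤n →
    let M≤m = ℕₚ.m⊔n≤o⇒m≤o M N L≤m
        M≤n = ℕₚ.m⊔n≤o⇒m≤o M N L≤n
        N≤m = ℕₚ.m⊔n≤o⇒n≤o M N L≤m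
        N≤n = ℕₚ.m⊔n≤o⇒n≤o M N L≤n
    in ∣-∣< (√approx m (seq x m)) (√approx n (seq x n))
         (√approx-step n m (seq x n) (seq x m) ε 0<ε (hN n N≤n) (≤-<-trans (≤∣∣ (seq x m - seq x n)) (hM m n M≤m M≤n)))
         (√approx-step m n (seq x m) (seq x n) ε 0<ε (hN m N≤m) (≤-<-trans (≤∣∣ (seq x n - seq x m)) (hM n m M≤n M≤m)))

infix 5 _+i_
record ℂ : Set where
  constructor _+i_
  field
    re im : ℝ
open ℂ public

infix 4 _≈ℂ_
_≈ℂ_ : Rel ℂ 0ℓ
z ≈ℂ w = re z ≈ℝ re w × im z ≈ℝ im w

fromℝ : ℝ → ℂ
fromℝ x = x +i fromℚ 0ℚ

0ℂ 1ℂ : ℂ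
0ℂ = fromℝ (fromℚ 0ℚ)
1ℂ = fromℝ (fromℚ 1ℚ)

infixl 6 _+ℂ_
infix  8 -ℂ_
infixl 7 _*ℂ_

_+ℂ_ : ℂ → ℂ → ℂ
z +ℂ w = (re z +ℝ re w) +i (im z +ℝ im w)

-ℂ_ : ℂ → ℂ
-ℂ z = (-ℝ re z) +i (-ℝ im z)

_*ℂ_ : ℂ → ℂ → ℂ
z *ℂ w = (re z *ℝ re w +ℝ -ℝ (im z *ℝ im w)) +i (re z *ℝ im w +ℝ im z *ℝ re w)

∣_∣ℂ : ℂ → ℝ
∣ z ∣ℂ = √ (re z *ℝ re z +ℝ im z *ℝ im z)

eval : Polynomial → ℂ → ℂ
eval []       z = 0ℂ
eval (c ∷ cs) z = fromℝ (fromℚ (fromℕ c)) +ℂ z *ℂ eval cs z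

-- With y = 1 + x, sorting the vertices by their gcd with p²q gives I = y^a (y^b + y^c − 1) + d (y − 1) y^b,
-- where a = (p−1)(q−1), b = p(p−1), c = q−1, d = p−1 are the numbers of vertices with gcd p, q, p², pq: an
-- independent set contains at most one vertex of gcd pq, and such a vertex excludes those of gcd p and p².
-- Put e = a − b. Unless (p, q) = (2, 3), I = y^b f with f = y^(e+b) + y^(e+c) − y^e + d (y − 1) and e, b, c ≥ 2.
-- For ∣y∣ ≤ 1/2 the term d (y − 1) dominates f, for ∣y∣ ≥ 2 the leading term does. Both bounds persist slightly beyond
-- these radii, uniformly over the Gaussian rationals approximating x, which yields the constructive inequalities.

module Submission where

open import Defs
open import Algebra.Bundles using (CommutativeRing)
import Algebra.Definitions.RawSemiring as RawSemiring
open import Algebra.Properties.CommutativeSemigroup using (interchange)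
import Algebra.Solver.Ring.AlmostCommutativeRing as ACR
import Algebra.Solver.Ring.Simple as RingSolver
open import Algebra.Structures using (IsCommutativeRing)
open import Data.Bool as Bool using (Bool; true; false; T; _∧_; _∨_; if_then_else_)
open import Data.Bool.Properties using (T-∧; T-∨; ∨-comm; ∧-zeroʳ)
open import Data.Empty using (⊥; ⊥-elim)
open import Data.Fin using (Fin; zero; suc; toℕ; fromℕ<)
import Data.Fin.Properties as Finₚ
open import Data.Fin.Subset using (Subset; inside; outside; _∈_) renaming (∣_∣ to card)
open import Data.Integer using (+_)
open import Data.List using (List; []; _∷_; _++_; map; filter; length; foldr; applyUpTo)
open import Data.List.Relation.Unary.All as All using (All; []; _∷_)
open import Data.Nat as ℕ using (ℕ; zero; suc; _≡ᵇ_)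
import Data.Nat.Properties as ℕₚ
open import Data.Product using (_×_; _,_; proj₁; proj₂; ∃-syntax)
open import Data.Rational as ℚ using (ℚ; 0ℚ; 1ℚ; ½; _/_)
import Data.Rational.Properties as ℚₚ
import Data.Rational.Solver as ℚ-Solver
open import Data.Sum using (_⊎_; inj₁; inj₂; reduce)
open import Data.Vec.Base using ([]; _∷_; here; there)
open import Function using (_∘_; id)
open import Function.Bundles using (_⇔_; Equivalence; mk⇔)
open import Level using (0ℓ)
open import Relation.Binary.PropositionalEquality
  using (_≡_; _≢_; refl; sym; trans; cong; cong₂; subst; subst₂; isEquivalence; module ≡-Reasoning)
open import Relation.Nullary using (¬_; Dec; does; yes; no; T?; contradiction)
open import Relation.Nullary.Decidable using (does-⇔; dec-true; dec-false; from-yes; from-no)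
open import Relation.Unary using (Pred; Decidable)

-- Gaussian rationals

-- Order and equality of these reals are undecidable, so the proof cannot split into cases on 1 + x
-- itself. Every estimate is a quantitative statement about Gaussian rationals, where comparison is
-- decidable; `located` then picks one of two overlapping alternatives along the approximating
-- sequence.
--
-- The multiple zero y = 0 is the obstacle on the inner side: I is small near x = -1, so no lower
-- bound on I can hold there. Bounding f from below instead makes I(x_n) → 0 force y_n → 0, which is
-- the excluded value x = -1.
--
-- On the outer side the obstacle is the unbounded coefficient d. It is beaten by the degree: deg f
-- is at least a = (p - 1)(q - 1), which is at least 4d once q ≥ 5, while (k + 1) / 2^k ≤ 1 for
-- every k.
--
-- The exceptional pair arises from e = (p - 1)(q - p - 1). This is 0 exactly for consecutive primes
-- and never 1; with e = 0 the term y^e is the constant 1, which d (y - 1) does not dominate when d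
-- = 1.

module GaussianRationals where
  open import Data.Rational using (_+_; _*_; -_)

  infix 5 _∔𝕚_
  record ℚ[i] : Set where
    constructor _∔𝕚_
    field
      Re Im : ℚ
  open ℚ[i] public

  0ᵍ 1ᵍ : ℚ[i]
  0ᵍ = 0ℚ ∔𝕚 0ℚ
  1ᵍ = 1ℚ ∔𝕚 0ℚ

  infixl 6 _+ᵍ_ _-ᵍ_
  infixl 7 _*ᵍ_
  infix  8 -ᵍ_

  _+ᵍ_ _*ᵍ_ : ℚ[i] → ℚ[i] → ℚ[i]
  u +ᵍ v = (Re u + Re v) ∔𝕚 (Im u + Im v)
  u *ᵍ v = (Re u * Re v + - (Im u * Im v)) ∔𝕚 (Re u * Im v + Im u * Re v)

  -ᵍ_ : ℚ[i] → ℚ[i]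
  -ᵍ u = (- Re u) ∔𝕚 (- Im u)

  _-ᵍ_ : ℚ[i] → ℚ[i] → ℚ[i]
  u -ᵍ v = u +ᵍ -ᵍ v

  ι : ℚ → ℚ[i]
  ι r = r ∔𝕚 0ℚ

  _≟ᵍ_ : (u v : ℚ[i]) → Dec (u ≡ v)
  (a ∔𝕚 b) ≟ᵍ (c ∔𝕚 d) with a ℚₚ.≟ c | b ℚₚ.≟ d
  ... | yes refl | yes refl = yes refl
  ... | no a≢c   | _        = no λ { refl → a≢c refl }
  ... | yes _    | no b≢d   = no λ { refl → b≢d refl }

  module _ where
    open ℚ-Solver.+-*-Solver

    *ᵍ-assoc : ∀ u v w → (u *ᵍ v) *ᵍ w ≡ u *ᵍ (v *ᵍ w)
    *ᵍ-assoc (a ∔𝕚 b) (c ∔𝕚 d) (e ∔𝕚 f) = cong₂ _∔𝕚_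
      (solve 6 (λ a b c d e f → (a :* c :+ :- (b :* d)) :* e :+ :- ((a :* d :+ b :* c) :* f)
        := a :* (c :* e :+ :- (d :* f)) :+ :- (b :* (c :* f :+ d :* e))) refl a b c d e f)
      (solve 6 (λ a b c d e f → (a :* c :+ :- (b :* d)) :* f :+ (a :* d :+ b :* c) :* e
        := a :* (c :* f :+ d :* e) :+ b :* (c :* e :+ :- (d :* f))) refl a b c d e f)

    *ᵍ-comm : ∀ u v → u *ᵍ v ≡ v *ᵍ u
    *ᵍ-comm (a ∔𝕚 b) (c ∔𝕚 d) = cong₂ _∔𝕚_
      (solve 4 (λ a b c d → a :* c :+ :- (b :* d) := c :* a :+ :- (d :* b)) refl a b c d)
      (solve 4 (λ a b c d → a :* d :+ b :* c := c :* b :+ d :* a) refl a b c d)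

    *ᵍ-identityˡ : ∀ u → 1ᵍ *ᵍ u ≡ u
    *ᵍ-identityˡ (a ∔𝕚 b) = cong₂ _∔𝕚_
      (solve 2 (λ a b → con 1ℚ :* a :+ :- (con 0ℚ :* b) := a) refl a b)
      (solve 2 (λ a b → con 1ℚ :* b :+ con 0ℚ :* a := b) refl a b)

    *ᵍ-distribˡ-+ᵍ : ∀ u v w → u *ᵍ (v +ᵍ w) ≡ u *ᵍ v +ᵍ u *ᵍ w
    *ᵍ-distribˡ-+ᵍ (a ∔𝕚 b) (c ∔𝕚 d) (e ∔𝕚 f) = cong₂ _∔𝕚_
      (solve 6 (λ a b c d e f → a :* (c :+ e) :+ :- (b :* (d :+ f))
        := (a :* c :+ :- (b :* d)) :+ (a :* e :+ :- (b :* f))) refl a b c d e f)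
      (solve 6 (λ a b c d e f → a :* (d :+ f) :+ b :* (c :+ e)
        := (a :* d :+ b :* c) :+ (a :* f :+ b :* e)) refl a b c d e f)

  ℚ[i]-isCommutativeRing : IsCommutativeRing _≡_ _+ᵍ_ _*ᵍ_ -ᵍ_ 0ᵍ 1ᵍ
  ℚ[i]-isCommutativeRing = record
    { isRing = record
      { +-isAbelianGroup = record
        { isGroup = record
          { isMonoid = record
            { isSemigroup = record
              { isMagma = record { isEquivalence = isEquivalence ; ∙-cong = cong₂ _+ᵍ_ }
              ; assoc = λ u v w → cong₂ _∔𝕚_ (ℚₚ.+-assoc (Re u) (Re v) (Re w)) (ℚₚ.+-assoc (Im u) (Im v) (Im w))
              }
            ; identity = (λ u → cong₂ _∔𝕚_ (ℚₚ.+-identityˡ (Re u)) (ℚₚ.+-identityˡ (Im u)))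
                       , (λ u → cong₂ _∔𝕚_ (ℚₚ.+-identityʳ (Re u)) (ℚₚ.+-identityʳ (Im u)))
            }
          ; inverse = (λ u → cong₂ _∔𝕚_ (ℚₚ.+-inverseˡ (Re u)) (ℚₚ.+-inverseˡ (Im u)))
                    , (λ u → cong₂ _∔𝕚_ (ℚₚ.+-inverseʳ (Re u)) (ℚₚ.+-inverseʳ (Im u)))
          ; ⁻¹-cong = cong (λ u → -ᵍ u)
          }
        ; comm = λ u v → cong₂ _∔𝕚_ (ℚₚ.+-comm (Re u) (Re v)) (ℚₚ.+-comm (Im u) (Im v))
        }
      ; *-cong = cong₂ _*ᵍ_
      ; *-assoc = *ᵍ-assoc
      ; *-identity = *ᵍ-identityˡ , λ u → trans (*ᵍ-comm u 1ᵍ) (*ᵍ-identityˡ u)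
      ; distrib = *ᵍ-distribˡ-+ᵍ , λ u v w → trans (*ᵍ-comm (v +ᵍ w) u)
          (trans (*ᵍ-distribˡ-+ᵍ u v w) (cong₂ _+ᵍ_ (*ᵍ-comm u v) (*ᵍ-comm u w)))
      }
    ; *-comm = *ᵍ-comm
    }

  ℚ[i]-commutativeRing : CommutativeRing 0ℓ 0ℓ
  ℚ[i]-commutativeRing = record { isCommutativeRing = ℚ[i]-isCommutativeRing }

  open CommutativeRing ℚ[i]-commutativeRing public
    using (semiring)
    renaming (+-identityˡ to +ᵍ-identityˡ; +-identityʳ to +ᵍ-identityʳ; +-assoc to +ᵍ-assoc; zeroʳ to *ᵍ-zeroʳ)
  open import Algebra.Properties.Semiring.Exp semiring public
    using () renaming (_^_ to _^ᵍ_; ^-homo-* to ^ᵍ-homo-+; ^-assocʳ to ^ᵍ-assocʳ)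

  module ℚ[i]-Solver = RingSolver (ACR.fromCommutativeRing ℚ[i]-commutativeRing) _≟ᵍ_

open GaussianRationals

-- Weighted sums over independent sets

-- ⟨ g ⟩ stands for the residues v with gcd(v, p²q) = g, and ⟨0⟩ for the residue 0.
data Class : Set where
  ⟨1⟩ ⟨p⟩ ⟨q⟩ ⟨p²⟩ ⟨pq⟩ ⟨0⟩ : Class

∣p ∣p² ∣q : Class → Bool
∣p ⟨1⟩ = false
∣p ⟨q⟩ = false
∣p _   = true
∣p² ⟨p²⟩ = true
∣p² ⟨0⟩  = true
∣p² _    = false
∣q ⟨q⟩  = true
∣q ⟨pq⟩ = true
∣q ⟨0⟩  = true
∣q _    = false

isVertex : Class → Bool
isVertex ⟨1⟩ = false
isVertex ⟨0⟩ = false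
isVertex _   = true

annihilates : Class → Class → Bool
annihilates k l = (∣p² k ∨ ∣p² l ∨ (∣p k ∧ ∣p l)) ∧ (∣q k ∨ ∣q l)

-- Once a vertex is chosen, those it annihilates are demoted to ⟨1⟩, the class of non-vertices; the count
-- of independent sets then depends on the classes alone and can be computed one vertex at a time.
exclude : Class → Class → Class
exclude k l = if annihilates k l then ⟨1⟩ else l

infix 4 _≗?_
_≗?_ : (P Q : Class → Bool) → Bool
P ≗? Q = agree ⟨1⟩ ∧ agree ⟨p⟩ ∧ agree ⟨q⟩ ∧ agree ⟨p²⟩ ∧ agree ⟨pq⟩ ∧ agree ⟨0⟩
  where
  agree : Class → Bool
  agree k = does (P k Bool.≟ Q k)

-- Proof by reflection: with six classes, the premise for concrete predicates evaluates to the unit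
-- type, so each claim about the effect of `exclude` is later settled by `_`.
≗?-sound : ∀ P Q → T (P ≗? Q) → ∀ k → P k ≡ Q k
≗?-sound P Q t with P ⟨1⟩ Bool.≟ Q ⟨1⟩ | P ⟨p⟩ Bool.≟ Q ⟨p⟩ | P ⟨q⟩ Bool.≟ Q ⟨q⟩
                  | P ⟨p²⟩ Bool.≟ Q ⟨p²⟩ | P ⟨pq⟩ Bool.≟ Q ⟨pq⟩ | P ⟨0⟩ Bool.≟ Q ⟨0⟩
... | yes h₁ | yes h₂ | yes h₃ | yes h₄ | yes h₅ | yes h₆ =
  λ { ⟨1⟩ → h₁ ; ⟨p⟩ → h₂ ; ⟨q⟩ → h₃ ; ⟨p²⟩ → h₄ ; ⟨pq⟩ → h₅ ; ⟨0⟩ → h₆ }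

admissible : ∀ {n} → (ℕ → Class) → Subset n → Bool
admissible f []            = true
admissible f (outside ∷ S) = admissible (f ∘ suc) S
admissible f (inside ∷ S)  = isVertex (f 0) ∧ admissible (exclude (f 0) ∘ f ∘ suc) S

ClassIndependent : ∀ {n} → (ℕ → Class) → Subset n → Set
ClassIndependent f S = (∀ v → v ∈ S → T (isVertex (f (toℕ v))))
  × (∀ u v → u ∈ S → v ∈ S → u ≢ v → ¬ T (annihilates (f (toℕ u)) (f (toℕ v))))

annihilates-sym : ∀ k l → annihilates k l ≡ annihilates l k
annihilates-sym k l = cong₂ _∧_ (lemma (∣p² k) (∣p² l) (∣p k) (∣p l)) (∨-comm (∣q k) (∣q l))
  where
  lemma : ∀ a b c d → a ∨ b ∨ (c ∧ d) ≡ b ∨ a ∨ (d ∧ c)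
  lemma false false false false = refl
  lemma false false false true  = refl
  lemma false false true  false = refl
  lemma false false true  true  = refl
  lemma false true  _     _     = refl
  lemma true  false _     _     = refl
  lemma true  true  _     _     = refl

-- A demoted residue is in `⟨1⟩` and can never be chosen. Still being a vertex after exclusion thus
-- certifies non-adjacency and that the original class survived.
exclude-vertex : ∀ k l → T (isVertex (exclude k l)) → ¬ T (annihilates k l) × exclude k l ≡ l
exclude-vertex k l t with annihilates k l
... | false = (λ ()) , refl

exclude-free : ∀ k l → ¬ T (annihilates k l) → exclude k l ≡ l
exclude-free k l h with annihilates k l
... | false = refl
... | true  = ⊥-elim (h _)

admissible-sound : ∀ {n} f (S : Subset n) → T (admissible f S) → ClassIndependent f S
admissible-sound f [] _ = (λ _ ()) , λ _ _ ()
admissible-sound f (outside ∷ S) t with admissible-sound (f ∘ suc) S t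
... | V , A = (λ { (suc v) (there v∈S) → V v v∈S })
            , (λ { (suc u) (suc v) (there u∈S) (there v∈S) u≢v → A u v u∈S v∈S (u≢v ∘ cong suc) })
admissible-sound f (inside ∷ S) t with Equivalence.to T-∧ t
... | t₀ , t₁ with admissible-sound (exclude (f 0) ∘ f ∘ suc) S t₁
... | V , A = vertices , nonadjacent
  where
  tail : ∀ v → v ∈ S → ¬ T (annihilates (f 0) (f (suc (toℕ v)))) × exclude (f 0) (f (suc (toℕ v))) ≡ f (suc (toℕ v))
  tail v v∈S = exclude-vertex (f 0) _ (V v v∈S)
  vertices : ∀ v → v ∈ inside ∷ S → T (isVertex (f (toℕ v)))
  vertices zero    _           = t₀
  vertices (suc v) (there v∈S) = subst (T ∘ isVertex) (proj₂ (tail v v∈S)) (V v v∈S)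
  nonadjacent : ∀ u v → u ∈ inside ∷ S → v ∈ inside ∷ S → u ≢ v → ¬ T (annihilates (f (toℕ u)) (f (toℕ v)))
  nonadjacent zero    zero    _           _           u≢v = ⊥-elim (u≢v refl)
  nonadjacent zero    (suc v) _           (there v∈S) _   = proj₁ (tail v v∈S)
  nonadjacent (suc u) zero    (there u∈S) _           _   =
    proj₁ (tail u u∈S) ∘ subst T (annihilates-sym (f (suc (toℕ u))) (f 0))
  nonadjacent (suc u) (suc v) (there u∈S) (there v∈S) u≢v =
    A u v u∈S v∈S (u≢v ∘ cong suc)
      ∘ subst₂ (λ k l → T (annihilates k l)) (sym (proj₂ (tail u u∈S))) (sym (proj₂ (tail v v∈S)))

admissible-complete : ∀ {n} f (S : Subset n) → ClassIndependent f S → T (admissible f S)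
admissible-complete f [] _ = _
admissible-complete f (outside ∷ S) (V , A) = admissible-complete (f ∘ suc) S
  ( (λ v v∈S → V (suc v) (there v∈S))
  , (λ u v u∈S v∈S u≢v → A (suc u) (suc v) (there u∈S) (there v∈S) (u≢v ∘ Finₚ.suc-injective)))
admissible-complete f (inside ∷ S) (V , A) = Equivalence.from T-∧
  ( V zero here
  , admissible-complete (exclude (f 0) ∘ f ∘ suc) S
    ( (λ v v∈S → subst (T ∘ isVertex) (sym (same v v∈S)) (V (suc v) (there v∈S)))
    , (λ u v u∈S v∈S u≢v → A (suc u) (suc v) (there u∈S) (there v∈S) (u≢v ∘ Finₚ.suc-injective)
         ∘ subst₂ (λ k l → T (annihilates k l)) (same u u∈S) (same v v∈S))))
  where
  same : ∀ v → v ∈ S → exclude (f 0) (f (suc (toℕ v))) ≡ f (suc (toℕ v))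
  same v v∈S = exclude-free (f 0) _ (A zero (suc v) here (there v∈S) λ ())

-- Finite sums and counts

sumOver : ∀ {A : Set} → (A → ℚ[i]) → List A → ℚ[i]
sumOver g []       = 0ᵍ
sumOver g (a ∷ as) = g a +ᵍ sumOver g as

sumOver-++ : ∀ {A : Set} (g : A → ℚ[i]) as bs → sumOver g (as ++ bs) ≡ sumOver g as +ᵍ sumOver g bs
sumOver-++ g []       bs = sym (+ᵍ-identityˡ (sumOver g bs))
sumOver-++ g (a ∷ as) bs = trans (cong (g a +ᵍ_) (sumOver-++ g as bs))
  (sym (+ᵍ-assoc (g a) (sumOver g as) (sumOver g bs)))

sumOver-map : ∀ {A B : Set} (g : B → ℚ[i]) (h : A → B) as → sumOver g (map h as) ≡ sumOver (g ∘ h) as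
sumOver-map g h []       = refl
sumOver-map g h (a ∷ as) = cong (g (h a) +ᵍ_) (sumOver-map g h as)

sumOver-cong : ∀ {A : Set} {g h : A → ℚ[i]} → (∀ a → g a ≡ h a) → ∀ as → sumOver g as ≡ sumOver h as
sumOver-cong g≗h []       = refl
sumOver-cong g≗h (a ∷ as) = cong₂ _+ᵍ_ (g≗h a) (sumOver-cong g≗h as)

sumOver-*ᵍ : ∀ {A : Set} c (g : A → ℚ[i]) as → sumOver (λ a → c *ᵍ g a) as ≡ c *ᵍ sumOver g as
sumOver-*ᵍ c g []       = sym (*ᵍ-zeroʳ c)
sumOver-*ᵍ c g (a ∷ as) = trans (cong (c *ᵍ g a +ᵍ_) (sumOver-*ᵍ c g as))
  (sym (*ᵍ-distribˡ-+ᵍ c (g a) (sumOver g as)))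

sumOver-filter : ∀ {A : Set} {P : Pred A 0ℓ} (P? : Decidable P) (g : A → ℚ[i]) as →
  sumOver g (filter P? as) ≡ sumOver (λ a → if does (P? a) then g a else 0ᵍ) as
sumOver-filter P? g [] = refl
sumOver-filter P? g (a ∷ as) with does (P? a)
... | true  = cong (g a +ᵍ_) (sumOver-filter P? g as)
... | false = trans (sumOver-filter P? g as) (sym (+ᵍ-identityˡ _))

bit : Bool → ℕ
bit b = if b then 1 else 0

count : {A : Set} → (A → Bool) → (ℕ → A) → ℕ → ℕ
count P f zero    = 0
count P f (suc n) = bit (P (f 0)) ℕ.+ count P (f ∘ suc) n

count-cong : ∀ {A B : Set} P (f : ℕ → A) P′ (f′ : ℕ → B) → (∀ i → P (f i) ≡ P′ (f′ i)) →
             ∀ n → count P f n ≡ count P′ f′ n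
count-cong P f P′ f′ h zero    = refl
count-cong P f P′ f′ h (suc n) = cong₂ ℕ._+_ (cong bit (h 0))
  (count-cong P (f ∘ suc) P′ (f′ ∘ suc) (h ∘ suc) n)

count-none : ∀ {A : Set} P (f : ℕ → A) n → (∀ i → i ℕ.< n → P (f i) ≡ false) → count P f n ≡ 0
count-none P f zero    h = refl
count-none P f (suc n) h rewrite h 0 (ℕ.s≤s ℕ.z≤n) = count-none P (f ∘ suc) n (λ i i<n → h (suc i) (ℕ.s≤s i<n))

is⟨p⟩ is⟨q⟩ is⟨p²⟩ is⟨pq⟩ : Class → Bool
is⟨p⟩ ⟨p⟩ = true
is⟨p⟩ _   = false
is⟨q⟩ ⟨q⟩ = true
is⟨q⟩ _   = false
is⟨p²⟩ ⟨p²⟩ = true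
is⟨p²⟩ _    = false
is⟨pq⟩ ⟨pq⟩ = true
is⟨pq⟩ _    = false

-- The deletion recurrence and its closed form

module _ (z : ℚ[i]) where

  private
    y : ℚ[i]
    y = 1ᵍ +ᵍ z

  weight : ∀ {n} → (ℕ → Class) → Subset n → ℚ[i]
  weight f S = if admissible f S then z ^ᵍ card S else 0ᵍ

  weightSum : (ℕ → Class) → ℕ → ℚ[i]
  weightSum f n = sumOver (weight f) (allSubsets n)

  closedForm : ℕ → ℕ → ℕ → ℕ → ℚ[i]
  closedForm a b c d = y ^ᵍ a *ᵍ (y ^ᵍ b +ᵍ y ^ᵍ c -ᵍ 1ᵍ) +ᵍ ι (fromℕ d) *ᵍ z *ᵍ y ^ᵍ b

  closedFormOf : (ℕ → Class) → ℕ → ℚ[i]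
  closedFormOf f n = closedForm (count is⟨p⟩ f n) (count is⟨q⟩ f n) (count is⟨p²⟩ f n) (count is⟨pq⟩ f n)

  -- The recurrence I(G) = I(G - v) + x I(G - N[v]) at the first element v: the shift by `suc`
  -- deletes v, and `exclude (f 0)` deletes its neighbours.
  weightSum-suc : ∀ f n → weightSum f (suc n) ≡ weightSum (f ∘ suc) n
    +ᵍ (if isVertex (f 0) then z *ᵍ weightSum (exclude (f 0) ∘ f ∘ suc) n else 0ᵍ)
  weightSum-suc f n = trans (sumOver-++ (weight f) (map (outside ∷_) Ss) (map (inside ∷_) Ss))
    (cong₂ _+ᵍ_ (sumOver-map (weight f) (outside ∷_) Ss)
                (trans (sumOver-map (weight f) (inside ∷_) Ss)
                (trans (sumOver-cong (scaled (isVertex (f 0))) Ss) (total (isVertex (f 0)) Ss))))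
    where
    Ss : List (Subset n)
    Ss = allSubsets n
    h : ℕ → Class
    h = exclude (f 0) ∘ f ∘ suc
    scaled : ∀ m S → (if m ∧ admissible h S then z ^ᵍ suc (card S) else 0ᵍ)
                     ≡ (if m then z *ᵍ weight h S else 0ᵍ)
    scaled false S = refl
    scaled true  S with admissible h S
    ... | true  = refl
    ... | false = sym (*ᵍ-zeroʳ z)
    total : ∀ m (as : List (Subset n)) → sumOver (λ S → if m then z *ᵍ weight h S else 0ᵍ) as
                                         ≡ (if m then z *ᵍ sumOver (weight h) as else 0ᵍ)
    total true  as       = sumOver-*ᵍ z (weight h) as
    total false []       = refl
    total false (a ∷ as) = trans (+ᵍ-identityˡ _) (total false as)

  closedForm-cong : ∀ {a a′ b b′ c c′ d d′} → a ≡ a′ → b ≡ b′ → c ≡ c′ → d ≡ d′ →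
                closedForm a b c d ≡ closedForm a′ b′ c′ d′
  closedForm-cong refl refl refl refl = refl

  -- Arbitrary class sequences are needed, because `exclude k ∘ g` no longer describes residues.
  -- Induction closes because excluding after a vertex of any class leaves each of the four counts
  -- unchanged or empties it. A vertex of class `⟨pq⟩` empties its own class too, which is why d
  -- enters linearly and not as an exponent.
  weightSum-closed : ∀ n f → weightSum f n ≡ closedFormOf f n
  weightSum-closed zero    f = solve 1 (λ z → con 1ᵍ :+ con 0ᵍ
    := con 1ᵍ :* (con 1ᵍ :+ con 1ᵍ :- con 1ᵍ) :+ con 0ᵍ :* z :* con 1ᵍ) refl z
    where open ℚ[i]-Solver
  weightSum-closed (suc n) f = trans (weightSum-suc f n) (step (f 0))
    where
    open ℚ[i]-Solver
    g : ℕ → Class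
    g = f ∘ suc
    a b c d : ℕ
    a = count is⟨p⟩ g n
    b = count is⟨q⟩ g n
    c = count is⟨p²⟩ g n
    d = count is⟨pq⟩ g n
    A B C D : ℚ[i]
    A = y ^ᵍ a
    B = y ^ᵍ b
    C = y ^ᵍ c
    D = ι (fromℕ d)
    kept : ∀ k P → T ((P ∘ exclude k) ≗? P) → count P (exclude k ∘ g) n ≡ count P g n
    kept k P t = count-cong P (exclude k ∘ g) P g (≗?-sound (P ∘ exclude k) P t ∘ g) n
    lost : ∀ k P → T ((P ∘ exclude k) ≗? λ _ → false) → count P (exclude k ∘ g) n ≡ 0
    lost k P t = count-none P (exclude k ∘ g) n (λ i _ → ≗?-sound (P ∘ exclude k) (λ _ → false) t (g i))
    combine : ∀ k {a′ b′ c′ d′ u} →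
      count is⟨p⟩ (exclude k ∘ g) n ≡ a′ → count is⟨q⟩ (exclude k ∘ g) n ≡ b′ →
      count is⟨p²⟩ (exclude k ∘ g) n ≡ c′ → count is⟨pq⟩ (exclude k ∘ g) n ≡ d′ →
      closedForm a b c d +ᵍ z *ᵍ closedForm a′ b′ c′ d′ ≡ u →
      weightSum g n +ᵍ z *ᵍ weightSum (exclude k ∘ g) n ≡ u
    combine k ea eb ec ed eq = trans
      (cong₂ (λ s t → s +ᵍ z *ᵍ t) (weightSum-closed n g)
        (trans (weightSum-closed n (exclude k ∘ g)) (closedForm-cong ea eb ec ed))) eq
    step : ∀ k → weightSum g n +ᵍ (if isVertex k then z *ᵍ weightSum (exclude k ∘ g) n else 0ᵍ)
      ≡ closedForm (bit (is⟨p⟩ k) ℕ.+ a) (bit (is⟨q⟩ k) ℕ.+ b) (bit (is⟨p²⟩ k) ℕ.+ c) (bit (is⟨pq⟩ k) ℕ.+ d)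
    step ⟨1⟩ = trans (+ᵍ-identityʳ _) (weightSum-closed n g)
    step ⟨0⟩ = trans (+ᵍ-identityʳ _) (weightSum-closed n g)
    step ⟨p⟩ = combine ⟨p⟩ (kept ⟨p⟩ is⟨p⟩ _) (kept ⟨p⟩ is⟨q⟩ _) (kept ⟨p⟩ is⟨p²⟩ _) (lost ⟨p⟩ is⟨pq⟩ _)
      (solve 5 (λ z A B C D →
          A :* (B :+ C :- con 1ᵍ) :+ D :* z :* B :+ z :* (A :* (B :+ C :- con 1ᵍ) :+ con 0ᵍ :* z :* B)
          := (con 1ᵍ :+ z) :* A :* (B :+ C :- con 1ᵍ) :+ D :* z :* B) refl z A B C D)
    step ⟨q⟩ = combine ⟨q⟩ (kept ⟨q⟩ is⟨p⟩ _) (kept ⟨q⟩ is⟨q⟩ _) (lost ⟨q⟩ is⟨p²⟩ _) (kept ⟨q⟩ is⟨pq⟩ _)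
      (solve 5 (λ z A B C D →
          A :* (B :+ C :- con 1ᵍ) :+ D :* z :* B :+ z :* (A :* (B :+ con 1ᵍ :- con 1ᵍ) :+ D :* z :* B)
          := A :* ((con 1ᵍ :+ z) :* B :+ C :- con 1ᵍ) :+ D :* z :* ((con 1ᵍ :+ z) :* B)) refl z A B C D)
    step ⟨p²⟩ = combine ⟨p²⟩ (kept ⟨p²⟩ is⟨p⟩ _) (lost ⟨p²⟩ is⟨q⟩ _) (kept ⟨p²⟩ is⟨p²⟩ _) (lost ⟨p²⟩ is⟨pq⟩ _)
      (solve 5 (λ z A B C D →
          A :* (B :+ C :- con 1ᵍ) :+ D :* z :* B :+ z :* (A :* (con 1ᵍ :+ C :- con 1ᵍ) :+ con 0ᵍ :* z :* con 1ᵍ)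
          := A :* (B :+ (con 1ᵍ :+ z) :* C :- con 1ᵍ) :+ D :* z :* B) refl z A B C D)
    step ⟨pq⟩ = combine ⟨pq⟩ (lost ⟨pq⟩ is⟨p⟩ _) (kept ⟨pq⟩ is⟨q⟩ _) (lost ⟨pq⟩ is⟨p²⟩ _) (lost ⟨pq⟩ is⟨pq⟩ _)
      (trans (solve 5 (λ z A B C D →
          A :* (B :+ C :- con 1ᵍ) :+ D :* z :* B :+ z :* (con 1ᵍ :* (B :+ con 1ᵍ :- con 1ᵍ) :+ con 0ᵍ :* z :* B)
          := A :* (B :+ C :- con 1ᵍ) :+ (D :+ con 1ᵍ) :* z :* B) refl z A B C D)
        (cong (λ r → A *ᵍ (B +ᵍ C -ᵍ 1ᵍ) +ᵍ ι r *ᵍ z *ᵍ B) (sym (fromℕ-suc d))))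

-- Coefficient lists as generating functions

evalᵍ : Polynomial → ℚ[i] → ℚ[i]
evalᵍ []       z = 0ᵍ
evalᵍ (c ∷ cs) z = ι (fromℕ c) +ᵍ z *ᵍ evalᵍ cs z

fromℕ-+ : ∀ m n → fromℕ (m ℕ.+ n) ≡ fromℕ m ℚ.+ fromℕ n
fromℕ-+ zero    n = sym (ℚₚ.+-identityˡ (fromℕ n))
fromℕ-+ (suc m) n = begin
  fromℕ (suc (m ℕ.+ n))          ≡⟨ fromℕ-suc (m ℕ.+ n) ⟩
  fromℕ (m ℕ.+ n) ℚ.+ 1ℚ         ≡⟨ cong (ℚ._+ 1ℚ) (fromℕ-+ m n) ⟩
  fromℕ m ℚ.+ fromℕ n ℚ.+ 1ℚ     ≡⟨ solve 2 (λ a b → a :+ b :+ con 1ℚ := a :+ con 1ℚ :+ b)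
      refl (fromℕ m) (fromℕ n) ⟩
  fromℕ m ℚ.+ 1ℚ ℚ.+ fromℕ n     ≡⟨ cong (ℚ._+ fromℕ n) (sym (fromℕ-suc m)) ⟩
  fromℕ (suc m) ℚ.+ fromℕ n      ∎
  where
  open ≡-Reasoning
  open ℚ-Solver.+-*-Solver

module _ (z : ℚ[i]) where

  evalᵍ-cong : ∀ {f g : ℕ → ℕ} → (∀ k → f k ≡ g k) → ∀ K →
    evalᵍ (applyUpTo f K) z ≡ evalᵍ (applyUpTo g K) z
  evalᵍ-cong h zero    = refl
  evalᵍ-cong h (suc K) = cong₂ (λ c u → ι (fromℕ c) +ᵍ z *ᵍ u) (h 0) (evalᵍ-cong (h ∘ suc) K)

  evalᵍ-zero : ∀ K → evalᵍ (applyUpTo (λ _ → 0) K) z ≡ 0ᵍ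
  evalᵍ-zero zero    = refl
  evalᵍ-zero (suc K) = trans (cong (λ u → 0ᵍ +ᵍ z *ᵍ u) (evalᵍ-zero K))
    (trans (+ᵍ-identityˡ (z *ᵍ 0ᵍ)) (*ᵍ-zeroʳ z))

  evalᵍ-+ : ∀ (f g : ℕ → ℕ) K → evalᵍ (applyUpTo (λ k → f k ℕ.+ g k) K) z
                                ≡ evalᵍ (applyUpTo f K) z +ᵍ evalᵍ (applyUpTo g K) z
  evalᵍ-+ f g zero    = refl
  evalᵍ-+ f g (suc K) = trans
    (cong₂ (λ c u → ι c +ᵍ z *ᵍ u) (fromℕ-+ (f 0) (g 0)) (evalᵍ-+ (f ∘ suc) (g ∘ suc) K))
    (solve 5 (λ z a b u v → (a :+ b) :+ z :* (u :+ v) := (a :+ z :* u) :+ (b :+ z :* v)) refl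
      z (ι (fromℕ (f 0))) (ι (fromℕ (g 0)))
      (evalᵍ (applyUpTo (f ∘ suc) K) z) (evalᵍ (applyUpTo (g ∘ suc) K) z))
    where open ℚ[i]-Solver

  evalᵍ-monomial : ∀ {m K} → m ℕ.< K → evalᵍ (applyUpTo (λ k → bit (m ≡ᵇ k)) K) z ≡ z ^ᵍ m
  evalᵍ-monomial {zero}  {suc K} _   = trans (cong (λ u → 1ᵍ +ᵍ z *ᵍ u) (evalᵍ-zero K))
    (trans (cong (1ᵍ +ᵍ_) (*ᵍ-zeroʳ z)) (+ᵍ-identityʳ 1ᵍ))
  evalᵍ-monomial {suc m} {suc K} m<K = trans
    (cong (λ u → 0ᵍ +ᵍ z *ᵍ u) (evalᵍ-monomial {m} {K} (ℕₚ.≤-pred m<K))) (+ᵍ-identityˡ (z *ᵍ z ^ᵍ m))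

  -- Exchange of summation: each element adds 1 to a single coefficient, that is, one monomial to
  -- the value. The bound `K` ensures that this coefficient lies within the list.
  evalᵍ-histogram : ∀ {A : Set} (h : A → ℕ) K as → All (λ a → h a ℕ.< K) as →
    evalᵍ (applyUpTo (λ k → length (filter (λ a → h a ℕ.≟ k) as)) K) z ≡ sumOver (λ a → z ^ᵍ h a) as
  evalᵍ-histogram h K []       []          = evalᵍ-zero K
  evalᵍ-histogram h K (a ∷ as) (ha<K ∷ as<K) = trans (evalᵍ-cong split K)
    (trans (evalᵍ-+ (λ k → bit (h a ≡ᵇ k)) (λ k → length (filter (λ a → h a ℕ.≟ k) as)) K)
           (cong₂ _+ᵍ_ (evalᵍ-monomial ha<K) (evalᵍ-histogram h K as as<K)))
    where
    split : ∀ k → length (filter (λ a → h a ℕ.≟ k) (a ∷ as))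
                  ≡ bit (h a ≡ᵇ k) ℕ.+ length (filter (λ a → h a ℕ.≟ k) as)
    split k with h a ≡ᵇ k
    ... | true  = refl
    ... | false = refl

  foldr-⊔-bound : ∀ {A : Set} (h : A → ℕ) as → All (λ a → h a ℕ.≤ foldr ℕ._⊔_ 0 (map h as)) as
  foldr-⊔-bound h []       = []
  foldr-⊔-bound h (a ∷ as) = ℕₚ.m≤m⊔n (h a) _
    ∷ All.map (λ le → ℕₚ.≤-trans le (ℕₚ.m≤n⊔m (h a) _)) (foldr-⊔-bound h as)

  evalᵍ-independencePolynomial : ∀ G →
    evalᵍ (independencePolynomial G) z ≡ sumOver (λ S → z ^ᵍ card S) (independentSets G)
  evalᵍ-independencePolynomial G = evalᵍ-histogram card (suc (α G)) (independentSets G)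
    (All.map ℕ.s≤s (foldr-⊔-bound card (independentSets G)))

  evalᵍ-classified : ∀ G (f : ℕ → Class) →
    (∀ S → Independent G S ⇔ ClassIndependent f S) →
    evalᵍ (independencePolynomial G) z ≡ closedFormOf z f (Graph.bound G)
  evalᵍ-classified G f h = begin
    evalᵍ (independencePolynomial G) z
      ≡⟨ evalᵍ-independencePolynomial G ⟩
    sumOver (λ S → z ^ᵍ card S) (independentSets G)
      ≡⟨ sumOver-filter (independent? G) (λ S → z ^ᵍ card S) (allSubsets n) ⟩
    sumOver (λ S → if does (independent? G S) then z ^ᵍ card S else 0ᵍ) (allSubsets n)
      ≡⟨ sumOver-cong (λ S → cong (if_then z ^ᵍ card S else 0ᵍ)
          (does-⇔ (equiv S) (independent? G S) (T? (admissible f S))))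
                      (allSubsets n) ⟩
    weightSum z f n
      ≡⟨ weightSum-closed z n f ⟩
    closedFormOf z f n ∎
    where
    open ≡-Reasoning
    n : ℕ
    n = Graph.bound G
    equiv : ∀ S → Independent G S ⇔ T (admissible f S)
    equiv S = mk⇔ (admissible-complete f S ∘ Equivalence.to (h S))
                  (Equivalence.from (h S) ∘ admissible-sound f S)

-- Bounds for the quotient polynomial

module Bounds where
  open import Data.Rational using (_+_; _*_; _-_; -_; _≤_; _<_; ∣_∣; positive; nonNegative)
  open import Data.Rational.Properties hiding (_≟_)
  open RawSemiring ℚ.+-*-rawSemiring using (_^_)

  norm : ℚ[i] → ℚ
  norm u = Re u * Re u + Im u * Im u

  -- The modulus of a Gaussian rational is irrational in general, so ∣u∣ ≤ r is expressed by squares.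
  infix 4 _≼_
  record _≼_ (u : ℚ[i]) (r : ℚ) : Set where
    constructor ≼-intro
    field
      0≤bound : 0ℚ ≤ r
      norm≤   : norm u ≤ r * r
  open _≼_

  ∣p∣*∣p∣≡p*p : ∀ p → ∣ p ∣ * ∣ p ∣ ≡ p * p
  ∣p∣*∣p∣≡p*p p with ∣p∣≡p∨∣p∣≡-p p
  ... | inj₁ e = cong₂ _*_ e e
  ... | inj₂ e = trans (cong₂ _*_ e e) (solve 1 (λ p → (:- p) :* (:- p) := p :* p) refl p)
    where open ℚ-Solver.+-*-Solver

  0≤square : ∀ r → 0ℚ ≤ r * r
  0≤square r = subst (0ℚ ≤_) (∣p∣*∣p∣≡p*p r) (square-mono ≤-refl (0≤∣p∣ r))

  0≤* : ∀ {r s} → 0ℚ ≤ r → 0ℚ ≤ s → 0ℚ ≤ r * s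
  0≤* {r} {s} 0≤r 0≤s = subst (_≤ r * s) (*-zeroˡ s) (*-monoʳ-≤-nonNeg s {{nonNegative 0≤s}} 0≤r)

  0≤norm : ∀ u → 0ℚ ≤ norm u
  0≤norm u = +-nonNeg _ _ (0≤square (Re u)) (0≤square (Im u))

  *-mono-≤ : ∀ {r r′ s s′} → 0ℚ ≤ r′ → 0ℚ ≤ s → r ≤ r′ → s ≤ s′ → r * s ≤ r′ * s′
  *-mono-≤ {r} {r′} {s} {s′} 0≤r′ 0≤s r≤ s≤ = ≤-trans
    (*-monoʳ-≤-nonNeg s {{nonNegative 0≤s}} r≤) (*-monoˡ-≤-nonNeg r′ {{nonNegative 0≤r′}} s≤)

  square-mono-< : ∀ {r s} → 0ℚ ≤ r → r < s → r * r < s * s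
  square-mono-< {r} {s} 0≤r r<s = ≤-<-trans
    (*-monoˡ-≤-nonNeg r {{nonNegative 0≤r}} (<⇒≤ r<s))
    (*-monoˡ-<-pos s {{positive (≤-<-trans 0≤r r<s)}} r<s)

  square-cancel-≤ : ∀ {r s} → 0ℚ ≤ s → r * r ≤ s * s → r ≤ s
  square-cancel-≤ 0≤s r²≤s² = ≮⇒≥ λ s<r → <-irrefl refl (<-≤-trans (square-mono-< 0≤s s<r) r²≤s²)

  module _ where
    open ℚ-Solver.+-*-Solver

    norm-homo-* : ∀ u v → norm (u *ᵍ v) ≡ norm u * norm v
    norm-homo-* u v = solve 4 (λ a b c d →
      (a :* c :+ :- (b :* d)) :* (a :* c :+ :- (b :* d)) :+ (a :* d :+ b :* c) :* (a :* d :+ b :* c)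
      := (a :* a :+ b :* b) :* (c :* c :+ d :* d)) refl (Re u) (Im u) (Re v) (Im v)

    square-* : ∀ r s → (r * r) * (s * s) ≡ (r * s) * (r * s)
    square-* = solve 2 (λ r s → (r :* r) :* (s :* s) := (r :* s) :* (r :* s)) refl

    -- Cauchy–Schwarz, from Lagrange's identity.
    inner≤ : ∀ {u v r s} → u ≼ r → v ≼ s → Re u * Re v + Im u * Im v ≤ r * s
    inner≤ {u} {v} {r} {s} (≼-intro 0≤r u≤) (≼-intro 0≤s v≤) = square-cancel-≤ (0≤* 0≤r 0≤s) (begin
      inner * inner                      ≡⟨ sym (+-identityʳ _) ⟩
      inner * inner + 0ℚ                 ≤⟨ +-monoʳ-≤ (inner * inner) (0≤square outer) ⟩
      inner * inner + outer * outer      ≡⟨ lagrange (Re u) (Im u) (Re v) (Im v) ⟩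
      norm u * norm v                    ≤⟨ *-mono-≤ (0≤square r) (0≤norm v) u≤ v≤ ⟩
      (r * r) * (s * s)                  ≡⟨ square-* r s ⟩
      (r * s) * (r * s)                  ∎)
      where
      open ≤-Reasoning
      inner outer : ℚ
      inner = Re u * Re v + Im u * Im v
      outer = Re u * Im v - Im u * Re v
      lagrange : ∀ a b c d → (a * c + b * d) * (a * c + b * d) + (a * d - b * c) * (a * d - b * c)
                             ≡ (a * a + b * b) * (c * c + d * d)
      lagrange = solve 4 (λ a b c d →
        (a :* c :+ b :* d) :* (a :* c :+ b :* d) :+ (a :* d :- b :* c) :* (a :* d :- b :* c)
        := (a :* a :+ b :* b) :* (c :* c :+ d :* d)) refl

    -- Triangle inequality: the cross term is twice the inner product, at most 2rs by
    -- Cauchy-Schwarz.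
    ≼-+ : ∀ {u v r s} → u ≼ r → v ≼ s → u +ᵍ v ≼ r + s
    ≼-+ {u} {v} {r} {s} u≼ v≼ = ≼-intro (+-nonNeg r s (0≤bound u≼) (0≤bound v≼)) (begin
      norm (u +ᵍ v)                                       ≡⟨ expand (Re u) (Im u) (Re v) (Im v) ⟩
      norm u + norm v + (inner + inner)                   ≤⟨ +-mono-≤ (+-mono-≤ (norm≤ u≼) (norm≤ v≼))
                                                               (+-mono-≤ (inner≤ u≼ v≼) (inner≤ u≼ v≼)) ⟩
      r * r + s * s + (r * s + r * s)                     ≡⟨ solve 2 (λ r s → r :* r :+ s :* s :+ (r :* s :+ r :* s)
                                                               := (r :+ s) :* (r :+ s)) refl r s ⟩
      (r + s) * (r + s)                                   ∎)
      where
      open ≤-Reasoning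
      inner : ℚ
      inner = Re u * Re v + Im u * Im v
      expand : ∀ a b c d → (a + c) * (a + c) + (b + d) * (b + d)
                           ≡ a * a + b * b + (c * c + d * d) + (a * c + b * d + (a * c + b * d))
      expand = solve 4 (λ a b c d → (a :+ c) :* (a :+ c) :+ (b :+ d) :* (b :+ d)
        := a :* a :+ b :* b :+ (c :* c :+ d :* d) :+ (a :* c :+ b :* d :+ (a :* c :+ b :* d))) refl

    ≼-neg : ∀ {u r} → u ≼ r → -ᵍ u ≼ r
    ≼-neg {u} {r} u≼ = ≼-intro (0≤bound u≼) (subst (_≤ r * r)
      (solve 2 (λ a b → a :* a :+ b :* b := (:- a) :* (:- a) :+ (:- b) :* (:- b))
          refl (Re u) (Im u)) (norm≤ u≼))

  ≼-* : ∀ {u v r s} → u ≼ r → v ≼ s → u *ᵍ v ≼ r * s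
  ≼-* {u} {v} {r} {s} u≼ v≼ = ≼-intro (0≤* (0≤bound u≼) (0≤bound v≼)) (begin
    norm (u *ᵍ v)        ≡⟨ norm-homo-* u v ⟩
    norm u * norm v      ≤⟨ *-mono-≤ (0≤square r) (0≤norm v) (norm≤ u≼) (norm≤ v≼) ⟩
    (r * r) * (s * s)    ≡⟨ square-* r s ⟩
    (r * s) * (r * s)    ∎)
    where open ≤-Reasoning

  ≼-weaken : ∀ {u r s} → r ≤ s → u ≼ r → u ≼ s
  ≼-weaken r≤s u≼ = ≼-intro (≤-trans (0≤bound u≼) r≤s) (≤-trans (norm≤ u≼) (square-mono (0≤bound u≼) r≤s))

  norm-ι : ∀ r → norm (ι r) ≡ r * r
  norm-ι r = +-identityʳ (r * r)

  ≼-ι : ∀ {r} → 0ℚ ≤ r → ι r ≼ r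
  ≼-ι {r} 0≤r = ≼-intro 0≤r (≤-reflexive (norm-ι r))

  -- How contradictions are extracted: terms are added until the left side collapses to a rational,
  -- and the resulting inequality in ℚ is refuted, in most uses directly by evaluation.
  ι-≼ : ∀ {r s} → ι r ≼ s → r ≤ s
  ι-≼ {r} {s} ιr≼s = square-cancel-≤ (0≤bound ιr≼s) (subst (_≤ s * s) (norm-ι r) (norm≤ ιr≼s))

  ≼-^≤1 : ∀ {u r} → u ≼ r → r ≤ 1ℚ → ∀ n → u ^ᵍ n ≼ 1ℚ
  ≼-^≤1 u≼ r≤1 zero    = ≼-ι (from-yes (0ℚ ≤? 1ℚ))
  ≼-^≤1 u≼ r≤1 (suc n) = ≼-* (≼-weaken r≤1 u≼) (≼-^≤1 u≼ r≤1 n)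

  ≼-^-suc : ∀ {u r} → u ≼ r → r ≤ 1ℚ → ∀ n → u ^ᵍ suc n ≼ r
  ≼-^-suc {u} {r} u≼ r≤1 n = subst (u ^ᵍ suc n ≼_) (*-identityʳ r) (≼-* u≼ (≼-^≤1 u≼ r≤1 n))

  ≼-^≥2 : ∀ {u r} → u ≼ r → r ≤ 1ℚ → ∀ {n} → 2 ℕ.≤ n → u ^ᵍ n ≼ r * r
  ≼-^≥2 u≼ r≤1 {suc (suc n)} (ℕ.s≤s (ℕ.s≤s _)) = ≼-* u≼ (≼-^-suc u≼ r≤1 n)

  ^ᵍ-inverse : ∀ {u w} → u *ᵍ w ≡ 1ᵍ → ∀ n → u ^ᵍ n *ᵍ w ^ᵍ n ≡ 1ᵍ
  ^ᵍ-inverse {u} {w} uw≡1 zero    = *ᵍ-identityˡ 1ᵍ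
  ^ᵍ-inverse {u} {w} uw≡1 (suc n) = trans
    (solve 4 (λ u U w W → (u :* U) :* (w :* W) := (u :* w) :* (U :* W)) refl u (u ^ᵍ n) w (w ^ᵍ n))
    (trans (cong₂ _*ᵍ_ uw≡1 (^ᵍ-inverse uw≡1 n)) (*ᵍ-identityˡ 1ᵍ))
    where open ℚ[i]-Solver

  -- Inductively (k + 2) v^(k+1) = (k + 1) v^k · v + v^(k+1), and each summand has modulus at most
  -- 1/2. This absorbs the unbounded coefficient d.
  linear-geometric : ∀ {v} → v ≼ ½ → ∀ k → ι (fromℕ (suc k)) *ᵍ v ^ᵍ k ≼ 1ℚ
  linear-geometric v≼ zero    = ≼-* {1ᵍ} {1ᵍ} (≼-ι (from-yes (0ℚ ≤? 1ℚ))) (≼-ι (from-yes (0ℚ ≤? 1ℚ)))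
  linear-geometric {v} v≼ (suc k) = subst (_≼ 1ℚ)
    (trans (solve 3 (λ D v V → (D :* V) :* v :+ v :* V := (D :+ con 1ᵍ) :* (v :* V))
        refl (ι (fromℕ (suc k))) v (v ^ᵍ k))
           (cong (λ r → ι r *ᵍ v ^ᵍ suc k) (sym (fromℕ-suc (suc k)))))
    (≼-+ (≼-* (linear-geometric v≼ k) v≼) (≼-^-suc v≼ (from-yes (½ ≤? 1ℚ)) k))
    where open ℚ[i]-Solver

  -- ∣y∣ ≤ ρ and ∣y⁻¹∣ ≤ σ are excluded, where ρ and σ exceed 1/2: the margin makes the final inequalities
  -- strict constructively, and κ bounds the relevant polynomials away from 0 there.
  ρ σ κ : ℚ
  ρ = + 13 / 25
  σ = + 10 / 19
  κ = + 1 / 100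

  σ≤1 : σ ≤ 1ℚ
  σ≤1 = from-yes (σ ≤? 1ℚ)

  quotientPolynomial : ℕ → ℕ → ℕ → ℕ → ℚ[i] → ℚ[i]
  quotientPolynomial e b c d y =
    y ^ᵍ e *ᵍ y ^ᵍ b +ᵍ y ^ᵍ e *ᵍ y ^ᵍ c -ᵍ y ^ᵍ e +ᵍ ι (fromℕ d) *ᵍ (y -ᵍ 1ᵍ)

  1≤fromℕ-suc : ∀ k → 1ℚ ≤ fromℕ (suc k)
  1≤fromℕ-suc k = subst (1ℚ ≤_) (sym (fromℕ-suc k))
    (subst (_≤ fromℕ k + 1ℚ) (+-identityˡ 1ℚ) (+-monoˡ-≤ 1ℚ (0≤fromℕ k)))

  -- Instead of a reverse triangle inequality, the defining equation is solved for d, which gives d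
  -- ≤ r₀ + dρ and hence 1 - ρ ≤ d (1 - ρ) ≤ r₀. But 1 - ρ = 0.48, whereas r₀ = 2ρ⁴ + ρ² + κ is
  -- below 0.43; the exponents being at least 2 is what makes r₀ so small.
  near-zero : ∀ {e b c k y} → 2 ℕ.≤ e → 2 ℕ.≤ b → 2 ℕ.≤ c → y ≼ ρ → ¬ quotientPolynomial e b c (suc k) y ≼ κ
  near-zero {e} {b} {c} {k} {y} 2≤e 2≤b 2≤c y≼ρ f≼κ = from-no (1ℚ - ρ ≤? r₀) (begin
    1ℚ - ρ                 ≡⟨ sym (*-identityˡ (1ℚ - ρ)) ⟩
    1ℚ * (1ℚ - ρ)          ≤⟨ *-monoʳ-≤-nonNeg (1ℚ - ρ) (1≤fromℕ-suc k) ⟩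
    d * (1ℚ - ρ)           ≡⟨ Q.solve 2 (λ d ρ → d Q.:* (Q.con 1ℚ Q.:- ρ) Q.:= d Q.:+ (Q.:- (d Q.:* ρ)))
        refl d ρ ⟩
    d + - (d * ρ)          ≤⟨ +-monoˡ-≤ (- (d * ρ)) (ι-≼ d≼) ⟩
    r₀ + d * ρ + - (d * ρ) ≡⟨ Q.solve 2 (λ r a → r Q.:+ a Q.:+ (Q.:- a) Q.:= r) refl r₀ (d * ρ) ⟩
    r₀                     ∎)
    where
    module Q = ℚ-Solver.+-*-Solver
    open ≤-Reasoning
    d r₀ : ℚ
    d = fromℕ (suc k)
    r₀ = (ρ * ρ) * (ρ * ρ) + (ρ * ρ) * (ρ * ρ) + ρ * ρ + κ
    E≼ : y ^ᵍ e ≼ ρ * ρ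
    E≼ = ≼-^≥2 y≼ρ (from-yes (ρ ≤? 1ℚ)) 2≤e
    B≼ : y ^ᵍ b ≼ ρ * ρ
    B≼ = ≼-^≥2 y≼ρ (from-yes (ρ ≤? 1ℚ)) 2≤b
    C≼ : y ^ᵍ c ≼ ρ * ρ
    C≼ = ≼-^≥2 y≼ρ (from-yes (ρ ≤? 1ℚ)) 2≤c
    d≼ : ι d ≼ r₀ + d * ρ
    d≼ = subst (_≼ r₀ + d * ρ)
      (solve 5 (λ E B C D y → E :* B :+ E :* C :+ (:- E) :+ (:- (E :* B :+ E :* C :- E :+ D :* (y :- con 1ᵍ))) :+ D :* y
          := D)
        refl (y ^ᵍ e) (y ^ᵍ b) (y ^ᵍ c) (ι d) y)
      (≼-+ (≼-+ (≼-+ (≼-+ (≼-* E≼ B≼) (≼-* E≼ C≼)) (≼-neg E≼)) (≼-neg f≼κ)) (≼-* (≼-ι (0≤fromℕ (suc k))) y≼ρ))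
      where open ℚ[i]-Solver

  -- With M = e + m + j the degree, multiplication by w^M = y^(-M) turns the quotient polynomial into
  -- 1 + w^j − w^(m+j) + d w^(M−1) − d w^M, and M ≥ 4d makes d w^(M−1) at most ∣w∣³.
  far-from-zero : ∀ {e m j k l y w} → 2 ℕ.≤ m → e ℕ.+ (m ℕ.+ j) ≡ 4 ℕ.+ (k ℕ.* 4 ℕ.+ l) →
    y *ᵍ w ≡ 1ᵍ → w ≼ σ →
    ¬ quotientPolynomial e (m ℕ.+ j) m (suc k) y *ᵍ w ^ᵍ (e ℕ.+ (m ℕ.+ j)) ≼ κ
  far-from-zero {e} {m} {j} {k} {l} {y} {w} 2≤m size yw≡1 w≼σ fW≼κ = conclude j refl
    where
    D V W : ℚ[i]
    D = ι (fromℕ (suc k))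
    V = w ^ᵍ (3 ℕ.+ (k ℕ.* 4 ℕ.+ l))
    W = w *ᵍ V
    W≡ : w ^ᵍ (e ℕ.+ (m ℕ.+ j)) ≡ W
    W≡ = cong (w ^ᵍ_) size
    W≡′ : W ≡ w ^ᵍ e *ᵍ (w ^ᵍ m *ᵍ w ^ᵍ j)
    W≡′ = trans (sym W≡) (trans (^ᵍ-homo-+ w e (m ℕ.+ j)) (cong (w ^ᵍ e *ᵍ_) (^ᵍ-homo-+ w m j)))
    expanded : quotientPolynomial e (m ℕ.+ j) m (suc k) y *ᵍ w ^ᵍ (e ℕ.+ (m ℕ.+ j))
               ≡ 1ᵍ +ᵍ w ^ᵍ j -ᵍ w ^ᵍ m *ᵍ w ^ᵍ j +ᵍ D *ᵍ V -ᵍ w *ᵍ (D *ᵍ V)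
    expanded = begin
      quotientPolynomial e (m ℕ.+ j) m (suc k) y *ᵍ w ^ᵍ (e ℕ.+ (m ℕ.+ j))
        ≡⟨ cong₂ (λ u W → (Ye *ᵍ u +ᵍ Ye *ᵍ Ym -ᵍ Ye +ᵍ D *ᵍ (y -ᵍ 1ᵍ)) *ᵍ W) (^ᵍ-homo-+ y m j) W≡ ⟩
      (Ye *ᵍ (Ym *ᵍ Yj) +ᵍ Ye *ᵍ Ym -ᵍ Ye +ᵍ D *ᵍ (y -ᵍ 1ᵍ)) *ᵍ W
        ≡⟨ solve 4 (λ P D y W → (P :+ D :* (y :- con 1ᵍ)) :* W := P :* W :+ D :* (y :* W) :- D :* W) refl
             (Ye *ᵍ (Ym *ᵍ Yj) +ᵍ Ye *ᵍ Ym -ᵍ Ye) D y W ⟩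
      (Ye *ᵍ (Ym *ᵍ Yj) +ᵍ Ye *ᵍ Ym -ᵍ Ye) *ᵍ W +ᵍ D *ᵍ (y *ᵍ W) -ᵍ D *ᵍ W
        ≡⟨ cong₂ (λ u v → u +ᵍ v -ᵍ D *ᵍ W) leading (cong (D *ᵍ_) yW≡V) ⟩
      (1ᵍ +ᵍ Wj -ᵍ Wm *ᵍ Wj) +ᵍ D *ᵍ V -ᵍ D *ᵍ W
        ≡⟨ solve 4 (λ P D w V → P :+ D :* V :- D :* (w :* V) := P :+ D :* V :- w :* (D :* V)) refl
             (1ᵍ +ᵍ Wj -ᵍ Wm *ᵍ Wj) D w V ⟩
      1ᵍ +ᵍ Wj -ᵍ Wm *ᵍ Wj +ᵍ D *ᵍ V -ᵍ w *ᵍ (D *ᵍ V) ∎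
      where
      open ≡-Reasoning
      open ℚ[i]-Solver
      Ye Ym Yj We Wm Wj : ℚ[i]
      Ye = y ^ᵍ e
      Ym = y ^ᵍ m
      Yj = y ^ᵍ j
      We = w ^ᵍ e
      Wm = w ^ᵍ m
      Wj = w ^ᵍ j
      yW≡V : y *ᵍ W ≡ V
      yW≡V = trans (sym (*ᵍ-assoc y w V)) (trans (cong (_*ᵍ V) yw≡1) (*ᵍ-identityˡ V))
      leading : (Ye *ᵍ (Ym *ᵍ Yj) +ᵍ Ye *ᵍ Ym -ᵍ Ye) *ᵍ W ≡ 1ᵍ +ᵍ Wj -ᵍ Wm *ᵍ Wj
      leading = begin
        (Ye *ᵍ (Ym *ᵍ Yj) +ᵍ Ye *ᵍ Ym -ᵍ Ye) *ᵍ W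
          ≡⟨ cong ((Ye *ᵍ (Ym *ᵍ Yj) +ᵍ Ye *ᵍ Ym -ᵍ Ye) *ᵍ_) W≡′ ⟩
        (Ye *ᵍ (Ym *ᵍ Yj) +ᵍ Ye *ᵍ Ym -ᵍ Ye) *ᵍ (We *ᵍ (Wm *ᵍ Wj))
          ≡⟨ solve 6 (λ Ye Ym Yj We Wm Wj → (Ye :* (Ym :* Yj) :+ Ye :* Ym :- Ye) :* (We :* (Wm :* Wj))
               := (Ye :* We) :* ((Ym :* Wm) :* (Yj :* Wj) :+ (Ym :* Wm) :* Wj :- Wm :* Wj)) refl Ye Ym Yj We Wm Wj ⟩
        (Ye *ᵍ We) *ᵍ ((Ym *ᵍ Wm) *ᵍ (Yj *ᵍ Wj) +ᵍ (Ym *ᵍ Wm) *ᵍ Wj -ᵍ Wm *ᵍ Wj)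
          ≡⟨ cong₂ (λ a b → a *ᵍ (b *ᵍ (Yj *ᵍ Wj) +ᵍ b *ᵍ Wj -ᵍ Wm *ᵍ Wj)) (^ᵍ-inverse yw≡1 e) (^ᵍ-inverse yw≡1 m) ⟩
        1ᵍ *ᵍ (1ᵍ *ᵍ (Yj *ᵍ Wj) +ᵍ 1ᵍ *ᵍ Wj -ᵍ Wm *ᵍ Wj)
          ≡⟨ cong (λ a → 1ᵍ *ᵍ (1ᵍ *ᵍ a +ᵍ 1ᵍ *ᵍ Wj -ᵍ Wm *ᵍ Wj)) (^ᵍ-inverse yw≡1 j) ⟩
        1ᵍ *ᵍ (1ᵍ *ᵍ 1ᵍ +ᵍ 1ᵍ *ᵍ Wj -ᵍ Wm *ᵍ Wj)
          ≡⟨ solve 2 (λ Wm Wj → con 1ᵍ :* (con 1ᵍ :* con 1ᵍ :+ con 1ᵍ :* Wj :- Wm :* Wj) := con 1ᵍ :+ Wj :- Wm :* Wj)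
              refl Wm Wj ⟩
        1ᵍ +ᵍ Wj -ᵍ Wm *ᵍ Wj ∎
    -- The exponent 3 + 4k + l is split as w³ · w^l · (w⁴)^k. Since σ⁴ < 1/2, `linear-geometric`
    -- applied to w⁴ absorbs d = k + 1.
    DV≼ : D *ᵍ V ≼ σ * (σ * σ)
    DV≼ = subst (_≼ σ * (σ * σ)) eq (≼-* (≼-* w³≼ (≼-^≤1 w≼σ σ≤1 l)) (linear-geometric w⁴≼ k))
      where
      open ℚ[i]-Solver
      w³≼ : w ^ᵍ 3 ≼ σ * (σ * σ)
      w³≼ = ≼-* w≼σ (≼-^≥2 w≼σ σ≤1 {2} ℕₚ.≤-refl)
      w⁴≼ : w ^ᵍ 4 ≼ ½
      w⁴≼ = ≼-weaken (from-yes (σ * (σ * (σ * σ)) ≤? ½)) (≼-* w≼σ w³≼)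
      eq : (w ^ᵍ 3 *ᵍ w ^ᵍ l) *ᵍ (D *ᵍ (w ^ᵍ 4) ^ᵍ k) ≡ D *ᵍ V
      eq = begin
        (w ^ᵍ 3 *ᵍ w ^ᵍ l) *ᵍ (D *ᵍ (w ^ᵍ 4) ^ᵍ k)
          ≡⟨ solve 4 (λ a b D c → (a :* b) :* (D :* c) := D :* (a :* (c :* b)))
              refl (w ^ᵍ 3) (w ^ᵍ l) D ((w ^ᵍ 4) ^ᵍ k) ⟩
        D *ᵍ (w ^ᵍ 3 *ᵍ ((w ^ᵍ 4) ^ᵍ k *ᵍ w ^ᵍ l))
          ≡⟨ cong (λ u → D *ᵍ (w ^ᵍ 3 *ᵍ (u *ᵍ w ^ᵍ l))) (trans (^ᵍ-assocʳ w 4 k) (cong (w ^ᵍ_) (ℕₚ.*-comm 4 k))) ⟩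
        D *ᵍ (w ^ᵍ 3 *ᵍ (w ^ᵍ (k ℕ.* 4) *ᵍ w ^ᵍ l))
          ≡⟨ cong (λ u → D *ᵍ (w ^ᵍ 3 *ᵍ u)) (sym (^ᵍ-homo-+ w (k ℕ.* 4) l)) ⟩
        D *ᵍ (w ^ᵍ 3 *ᵍ w ^ᵍ (k ℕ.* 4 ℕ.+ l))
          ≡⟨ cong (D *ᵍ_) (sym (^ᵍ-homo-+ w 3 (k ℕ.* 4 ℕ.+ l))) ⟩
        D *ᵍ V ∎
        where open ≡-Reasoning
    Wm≼ : w ^ᵍ m ≼ σ * σ
    Wm≼ = ≼-^≥2 w≼σ σ≤1 2≤m
    rhs≼κ : 1ᵍ +ᵍ w ^ᵍ j -ᵍ w ^ᵍ m *ᵍ w ^ᵍ j +ᵍ D *ᵍ V -ᵍ w *ᵍ (D *ᵍ V) ≼ κ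
    rhs≼κ = subst (_≼ κ) expanded fW≼κ
    tail : ℚ
    tail = σ * (σ * σ) + σ * (σ * (σ * σ)) + κ
    tail≼ : (-ᵍ (D *ᵍ V)) +ᵍ w *ᵍ (D *ᵍ V) +ᵍ (1ᵍ +ᵍ w ^ᵍ j -ᵍ w ^ᵍ m *ᵍ w ^ᵍ j +ᵍ D *ᵍ V -ᵍ w *ᵍ (D *ᵍ V)) ≼ tail
    tail≼ = ≼-+ (≼-+ (≼-neg DV≼) (≼-* w≼σ DV≼)) rhs≼κ
    conclude : ∀ i → i ≡ j → ⊥
    -- For j = 0 the term w^j is not small but equals 1, and it reinforces the leading 1: the
    -- contradiction is 2 ≤ 0.51 approximately.
    conclude zero refl = from-no (1ℚ + 1ℚ ≤? σ * σ + tail) (ι-≼ (subst (_≼ σ * σ + tail)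
      (solve 3 (λ Wm X w → Wm :+ ((:- X) :+ w :* X :+ (con 1ᵍ :+ con 1ᵍ :- Wm :* con 1ᵍ :+ X :- w :* X))
          := con (ι (1ℚ + 1ℚ))) refl
        (w ^ᵍ m) (D *ᵍ V) w)
      (≼-+ Wm≼ tail≼)))
      where open ℚ[i]-Solver
    -- For j ≥ 1 the term w^j is only bounded by σ; the right-hand side is about 0.905. This is the
    -- tightest use of σ.
    conclude (suc i) refl = from-no (1ℚ ≤? σ + σ * σ * σ + tail) (ι-≼ (subst (_≼ σ + σ * σ * σ + tail)
      (solve 4 (λ Wj Wm X w → ((:- Wj) :+ Wm :* Wj) :+ ((:- X) :+ w :* X :+ (con 1ᵍ :+ Wj :- Wm :* Wj :+ X :- w :* X))
          := con 1ᵍ) refl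
        (w ^ᵍ j) (w ^ᵍ m) (D *ᵍ V) w)
      (≼-+ (≼-+ (≼-neg Wj≼) (≼-* Wm≼ Wj≼)) tail≼)))
      where
      open ℚ[i]-Solver
      Wj≼ : w ^ᵍ j ≼ σ
      Wj≼ = ≼-^-suc w≼σ σ≤1 i

  quotientPolynomial-comm : ∀ e b c d y → quotientPolynomial e b c d y ≡ quotientPolynomial e c b d y
  quotientPolynomial-comm e b c d y =
    solve 4 (λ P Q E D → P :+ Q :- E :+ D := Q :+ P :- E :+ D) refl
      (y ^ᵍ e *ᵍ y ^ᵍ b) (y ^ᵍ e *ᵍ y ^ᵍ c) (y ^ᵍ e) (ι (fromℕ d) *ᵍ (y -ᵍ 1ᵍ))
    where open ℚ[i]-Solver

  closedForm-factor : ∀ z e b c d → closedForm z (e ℕ.+ b) b c d ≡ (1ᵍ +ᵍ z) ^ᵍ b *ᵍ quotientPolynomial e b c d (1ᵍ +ᵍ z)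
  closedForm-factor z e b c d = trans
    (cong (λ u → u *ᵍ (B +ᵍ C -ᵍ 1ᵍ) +ᵍ D *ᵍ z *ᵍ B) (^ᵍ-homo-+ (1ᵍ +ᵍ z) e b))
    (solve 5 (λ z E B C D → (E :* B) :* (B :+ C :- con 1ᵍ) :+ D :* z :* B
      := B :* (E :* B :+ E :* C :- E :+ D :* (con 1ᵍ :+ z :- con 1ᵍ))) refl z E B C D)
    where
    open ℚ[i]-Solver
    B C D E : ℚ[i]
    B = (1ᵍ +ᵍ z) ^ᵍ b
    C = (1ᵍ +ᵍ z) ^ᵍ c
    D = ι (fromℕ d)
    E = (1ᵍ +ᵍ z) ^ᵍ e

  -- All that the limit argument needs to know of `I`. `near` bounds the quotient because the power
  -- of y makes `I` itself small there; `far` can speak of `I`, and takes the inverse of y as an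
  -- explicit `w`, whose smallness drives the estimate.
  record Estimates (I : ℚ[i] → ℚ[i]) : Set where
    field
      multiplicity : ℕ
      quotient     : ℚ[i] → ℚ[i]
      factored     : ∀ z → I z ≡ (1ᵍ +ᵍ z) ^ᵍ multiplicity *ᵍ quotient z
      near         : ∀ z → (1ᵍ +ᵍ z) ≼ ρ → ¬ quotient z ≼ κ
      far          : ∀ z w → (1ᵍ +ᵍ z) *ᵍ w ≡ 1ᵍ → w ≼ σ → ¬ I z ≼ κ

  Estimates-cong : ∀ {I J} → (∀ z → I z ≡ J z) → Estimates J → Estimates I
  Estimates-cong I≗J est = record
    { multiplicity = E.multiplicity
    ; quotient     = E.quotient
    ; factored     = λ z → trans (I≗J z) (E.factored z)
    ; near         = E.near
    ; far          = λ z w yw≡1 w≼σ I≼κ → E.far z w yw≡1 w≼σ (subst (_≼ κ) (I≗J z) I≼κ)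
    }
    where module E = Estimates est

  -- Powers of w have modulus at most 1, so multiplying `I` by them keeps its bound, while w^n
  -- cancels u^n.
  ≼-divide : ∀ u w f n m {I r} → u *ᵍ w ≡ 1ᵍ → w ≼ σ → I ≡ u ^ᵍ n *ᵍ f → I ≼ r → f *ᵍ w ^ᵍ m ≼ r
  ≼-divide u w f n m {I} {r} uw≡1 w≼σ I≡uⁿf I≼r =
    subst₂ _≼_ eq (*-identityʳ r) (≼-* I≼r (≼-* (≼-^≤1 w≼σ σ≤1 n) (≼-^≤1 w≼σ σ≤1 m)))
    where
    open ℚ[i]-Solver
    eq : I *ᵍ (w ^ᵍ n *ᵍ w ^ᵍ m) ≡ f *ᵍ w ^ᵍ m
    eq = trans (cong (_*ᵍ (w ^ᵍ n *ᵍ w ^ᵍ m)) I≡uⁿf)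
      (trans (solve 4 (λ U f W V → (U :* f) :* (W :* V) := (U :* W) :* (f :* V))
          refl (u ^ᵍ n) f (w ^ᵍ n) (w ^ᵍ m))
      (trans (cong (_*ᵍ (f *ᵍ w ^ᵍ m)) (^ᵍ-inverse {u} {w} uw≡1 n)) (*ᵍ-identityˡ (f *ᵍ w ^ᵍ m))))

  -- The quotient is symmetric in b and c, and either may be the larger: b = 6, c = 4 for (3, 5),
  -- but b = 2, c = 6 for (2, 7). `far-from-zero` is applied with m the smaller one and j the
  -- difference. The last hypothesis says 4d ≤ a.
  estimates-generic : ∀ e b c k → 2 ℕ.≤ e → 2 ℕ.≤ b → 2 ℕ.≤ c → 4 ℕ.+ k ℕ.* 4 ℕ.≤ e ℕ.+ b →
    Estimates (λ z → closedForm z (e ℕ.+ b) b c (suc k))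
  estimates-generic e b c k 2≤e 2≤b 2≤c size = record
    { multiplicity = b
    ; quotient     = λ z → quotientPolynomial e b c (suc k) (1ᵍ +ᵍ z)
    ; factored     = λ z → closedForm-factor z e b c (suc k)
    ; near         = λ z → near-zero {e} {b} {c} {k} 2≤e 2≤b 2≤c
    ; far          = far
    }
    where
    far : ∀ z w → (1ᵍ +ᵍ z) *ᵍ w ≡ 1ᵍ → w ≼ σ → ¬ closedForm z (e ℕ.+ b) b c (suc k) ≼ κ
    far z w yw≡1 w≼σ I≼κ with ℕₚ.≤-total c b
    ... | inj₁ c≤b with ℕₚ.m≤n⇒∃[o]m+o≡n c≤b | ℕₚ.m≤n⇒∃[o]m+o≡n size
    ...   | j , refl | l , size≡ = far-from-zero {e} {c} {j} {k} {l} {1ᵍ +ᵍ z} {w} 2≤c (sym size≡) yw≡1 w≼σ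
      (≼-divide (1ᵍ +ᵍ z) w (quotientPolynomial e (c ℕ.+ j) c (suc k) (1ᵍ +ᵍ z)) (c ℕ.+ j) (e ℕ.+ (c ℕ.+ j))
        yw≡1 w≼σ (closedForm-factor z e (c ℕ.+ j) c (suc k)) I≼κ)
    far z w yw≡1 w≼σ I≼κ | inj₂ b≤c
      with ℕₚ.m≤n⇒∃[o]m+o≡n b≤c | ℕₚ.m≤n⇒∃[o]m+o≡n (ℕₚ.≤-trans size (ℕₚ.+-monoʳ-≤ e b≤c))
    ...   | j , refl | l , size≡ = far-from-zero {e} {b} {j} {k} {l} {1ᵍ +ᵍ z} {w} 2≤b (sym size≡) yw≡1 w≼σ
      (subst (λ f → f *ᵍ w ^ᵍ (e ℕ.+ (b ℕ.+ j)) ≼ κ) (quotientPolynomial-comm e b (b ℕ.+ j) (suc k) (1ᵍ +ᵍ z))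
        (≼-divide (1ᵍ +ᵍ z) w (quotientPolynomial e b (b ℕ.+ j) (suc k) (1ᵍ +ᵍ z)) b (e ℕ.+ (b ℕ.+ j))
          yw≡1 w≼σ (closedForm-factor z e b (b ℕ.+ j) (suc k)) I≼κ))

  -- Here the quotient is 2y² + y − 2.
  estimates-p=2,q=3 : Estimates (λ z → closedForm z 2 2 2 1)
  estimates-p=2,q=3 = record
    { multiplicity = 2
    ; quotient     = λ z → quotientPolynomial 0 2 2 1 (1ᵍ +ᵍ z)
    ; factored     = λ z → closedForm-factor z 0 2 2 1
    ; near         = λ z → near (1ᵍ +ᵍ z)
    ; far          = λ z w yw≡1 w≼σ I≼κ → far (1ᵍ +ᵍ z) w yw≡1 w≼σ
        (≼-divide (1ᵍ +ᵍ z) w (f (1ᵍ +ᵍ z)) 2 2 yw≡1 w≼σ (closedForm-factor z 0 2 2 1) I≼κ)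
    }
    where
    open ℚ[i]-Solver
    f : ℚ[i] → ℚ[i]
    f y = quotientPolynomial 0 2 2 1 y
    near : ∀ y → y ≼ ρ → ¬ f y ≼ κ
    near y y≼ρ f≼κ = from-no (1ℚ + 1ℚ ≤? ρ * ρ + ρ * ρ + ρ + κ) (ι-≼ (subst (_≼ ρ * ρ + ρ * ρ + ρ + κ)
      (solve 2 (λ y Y → Y :+ Y :+ y :+ (:- (con 1ᵍ :* Y :+ con 1ᵍ :* Y :- con 1ᵍ :+ con 1ᵍ :* (y :- con 1ᵍ)))
          := con (ι (1ℚ + 1ℚ)))
        refl y (y ^ᵍ 2))
      (≼-+ (≼-+ (≼-+ y²≼ y²≼) y≼ρ) (≼-neg f≼κ))))
      where
      y²≼ : y ^ᵍ 2 ≼ ρ * ρ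
      y²≼ = ≼-^≥2 y≼ρ (from-yes (ρ ≤? 1ℚ)) {2} ℕₚ.≤-refl
    far : ∀ y w → y *ᵍ w ≡ 1ᵍ → w ≼ σ → ¬ f y *ᵍ w ^ᵍ 2 ≼ κ
    far y w yw≡1 w≼σ fw²≼κ = from-no (1ℚ + 1ℚ ≤? σ * σ + σ * σ + σ + κ) (ι-≼ (subst (_≼ σ * σ + σ * σ + σ + κ)
      (solve 2 (λ w W → W :+ W :+ (:- w) :+ (con 1ᵍ :+ con 1ᵍ :- W :- W :+ w) := con (ι (1ℚ + 1ℚ)))
          refl w (w ^ᵍ 2))
      (≼-+ (≼-+ (≼-+ w²≼ w²≼) (≼-neg w≼σ)) (subst (_≼ κ) expanded fw²≼κ))))
      where
      w²≼ : w ^ᵍ 2 ≼ σ * σ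
      w²≼ = ≼-^≥2 w≼σ σ≤1 {2} ℕₚ.≤-refl
      expanded : f y *ᵍ w ^ᵍ 2 ≡ 1ᵍ +ᵍ 1ᵍ -ᵍ w ^ᵍ 2 -ᵍ w ^ᵍ 2 +ᵍ w
      expanded = trans
        (solve 2 (λ y w → let Y = y :* (y :* con 1ᵍ) ; W = w :* (w :* con 1ᵍ) in
          (con 1ᵍ :* Y :+ con 1ᵍ :* Y :- con 1ᵍ :+ con 1ᵍ :* (y :- con 1ᵍ)) :* W
          := (y :* w) :* (y :* w) :+ (y :* w) :* (y :* w) :- W :- W :+ (y :* w) :* w) refl y w)
        (trans (cong (λ u → u *ᵍ u +ᵍ u *ᵍ u -ᵍ w ^ᵍ 2 -ᵍ w ^ᵍ 2 +ᵍ u *ᵍ w) yw≡1)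
          (solve 2 (λ W w → con 1ᵍ :* con 1ᵍ :+ con 1ᵍ :* con 1ᵍ :- W :- W :+ con 1ᵍ :* w
            := con 1ᵍ :+ con 1ᵍ :- W :- W :+ w) refl (w ^ᵍ 2) w))

  -- Passage to the limit

  at : ℂ → ℕ → ℚ[i]
  at z n = seq (re z) n ∔𝕚 seq (im z) n

  -- The Gaussian operations copy the termwise formulas of the complex ones, so taking the n-th
  -- approximation commutes with them by computation.
  eval-at : ∀ P z n → at (eval P z) n ≡ evalᵍ P (at z n)
  eval-at []       z n = refl
  eval-at (c ∷ cs) z n = cong (λ u → ι (fromℕ c) +ᵍ at z n *ᵍ u) (eval-at cs z n)

  Eventually : (ℕ → Set) → Set
  Eventually P = ∃[ N ] (∀ n → N ℕ.≤ n → P n)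

  eventually-× : ∀ {P Q : ℕ → Set} → Eventually P → Eventually Q → Eventually (λ n → P n × Q n)
  eventually-× (M , h) (N , k) = M ℕ.⊔ N , λ n le → h n (ℕₚ.m⊔n≤o⇒m≤o M N le) , k n (ℕₚ.m⊔n≤o⇒n≤o M N le)

  eventually-map : ∀ {P Q : ℕ → Set} → (∀ n → P n → Q n) → Eventually P → Eventually Q
  eventually-map f (N , h) = N , λ n le → f n (h n le)

  ∣-∣<⇒< : ∀ {a b ε} → ∣ a - b ∣ < ε → a < b + ε
  ∣-∣<⇒< {a} {b} {ε} h = begin-strict
    a              ≡⟨ solve 2 (λ a b → a := b :+ (a :- b)) refl a b ⟩
    b + (a - b)    <⟨ +-monoʳ-< b (≤-<-trans (≤∣∣ (a - b)) h) ⟩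
    b + ε          ∎
    where
    open ≤-Reasoning
    open ℚ-Solver.+-*-Solver

  -- Cotransitivity of the order: a single rational, taken where the sequence varies by less than
  -- half the gap, is compared with the midpoint of a and b. The other half of the gap covers all
  -- later terms.
  located : ∀ x {a b} → a < b → Eventually (λ n → a ≤ seq x n) ⊎ Eventually (λ n → seq x n ≤ b)
  located x {a} {b} a<b = decide (a + ε ≤? seq x N)
    where
    open ℚ-Solver.+-*-Solver
    ε : ℚ
    ε = ½ * (b - a)
    0<ε : 0ℚ < ε
    0<ε = *-pos 0<½ (subst (_< b - a) (+-inverseʳ a) (+-monoˡ-< (- a) a<b))
    N : ℕ
    N = proj₁ (cauchy x ε 0<ε)
    close : ∀ m n → N ℕ.≤ m → N ℕ.≤ n → seq x m < seq x n + ε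
    close m n N≤m N≤n = ∣-∣<⇒< (proj₂ (cauchy x ε 0<ε) m n N≤m N≤n)
    decide : Dec (a + ε ≤ seq x N) → _
    decide (yes a+ε≤) = inj₁ (N , λ n N≤n → begin
      a                          ≡⟨ solve 2 (λ a e → a := a :+ e :- e) refl a ε ⟩
      a + ε - ε                  ≤⟨ +-monoˡ-≤ (- ε) (≤-trans a+ε≤ (<⇒≤ (close N n ℕₚ.≤-refl N≤n))) ⟩
      seq x n + ε - ε            ≡⟨ solve 2 (λ a e → a :+ e :- e := a) refl (seq x n) ε ⟩
      seq x n                    ∎)
      where open ≤-Reasoning
    decide (no a+ε≰) = inj₂ (N , λ n N≤n → begin
      seq x n                    ≤⟨ <⇒≤ (close n N N≤n ℕₚ.≤-refl) ⟩
      seq x N + ε                ≤⟨ +-monoˡ-≤ ε (<⇒≤ (≰⇒> a+ε≰)) ⟩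
      a + ε + ε                  ≡⟨ solve 2 (λ a b → a :+ con ½ :* (b :- a) :+ con ½ :* (b :- a) := b)
          refl a b ⟩
      b                          ∎)
      where open ≤-Reasoning

  -- One ε pays for the error `mesh n` of the root approximation, the other is the gap that `_<ℝ_`
  -- demands.
  <√ : ∀ x c ε → 0ℚ ≤ c → 0ℚ < ε → Eventually (λ n → (c + ε + ε) * (c + ε + ε) ≤ seq x n) → fromℚ c <ℝ √ x
  <√ x c ε 0≤c 0<ε large = ε , 0<ε , eventually-map below (eventually-× large (archimedean ε 0<ε))
    where
    below : ∀ n → (c + ε + ε) * (c + ε + ε) ≤ seq x n × mesh n ≤ ε → c + ε ≤ √approx n (seq x n)
    below n (large , mesh≤) = ≮⇒≥ λ root< → <-irrefl refl (<-≤-trans (√approx-above n (seq x n)) (≤-trans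
      (square-mono (+-nonNeg _ _ (√approx-nonNeg n (seq x n)) (<⇒≤ (0<mesh n))) (+-mono-≤ (<⇒≤ root<) mesh≤)) large))

  -- The approximations lie below the root, so here no error term arises and ε serves only as the
  -- gap.
  √< : ∀ x c ε → 0ℚ ≤ c → 0ℚ < ε → Eventually (λ n → seq x n ≤ c * c) → √ x <ℝ fromℚ (c + ε)
  √< x c ε 0≤c 0<ε small = ε , 0<ε , eventually-map above small
    where
    above : ∀ n → seq x n ≤ c * c → √approx n (seq x n) + ε ≤ c + ε
    above n xₙ≤ = +-monoˡ-≤ ε (bound (√approx-below n (seq x n)))
      where
      bound : √approx n (seq x n) ≡ 0ℚ ⊎ √approx n (seq x n) * √approx n (seq x n) ≤ seq x n → √approx n (seq x n) ≤ c
      bound (inj₁ e) = subst (_≤ c) (sym e) 0≤c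
      bound (inj₂ h) = square-cancel-≤ 0≤c (≤-trans h xₙ≤)

  -- Closeness within 1 is requested as well, since it gives a² ≤ ∣a∣; no rational square root of δ
  -- is then needed.
  norm-vanishes : ∀ {w} → w ≈ℂ 0ℂ → ∀ δ → 0ℚ < δ → Eventually (λ n → norm (at w n) < δ)
  norm-vanishes {w} (re≈0 , im≈0) δ 0<δ =
    eventually-map (λ n ((r₁ , r₂) , (i₁ , i₂)) → subst (norm (at w n) <_) (half+half δ) (+-mono-<
       (term (seq (re w) n) r₁ r₂) (term (seq (im w) n) i₁ i₂)))
      (eventually-× (eventually-× (re≈0 1ℚ 0<1) (re≈0 (½ * δ) 0<½δ)) (eventually-× (im≈0 1ℚ 0<1) (im≈0 (½ * δ) 0<½δ)))
    where
    0<1 : 0ℚ < 1ℚ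
    0<1 = from-yes (0ℚ <? 1ℚ)
    0<½δ : 0ℚ < ½ * δ
    0<½δ = *-pos 0<½ 0<δ
    term : ∀ a → ∣ a - 0ℚ ∣ < 1ℚ → ∣ a - 0ℚ ∣ < ½ * δ → a * a < ½ * δ
    term a h₁ h₂ = begin-strict
      a * a                  ≡⟨ cong (λ b → b * b) (sym (+-identityʳ a)) ⟩
      (a - 0ℚ) * (a - 0ℚ)    ≡⟨ sym (∣p∣*∣p∣≡p*p (a - 0ℚ)) ⟩
      ∣ a - 0ℚ ∣ * ∣ a - 0ℚ ∣  ≤⟨ *-monoʳ-≤-nonNeg ∣ a - 0ℚ ∣ {{nonNegative (0≤∣p∣ (a - 0ℚ))}} (<⇒≤ h₁) ⟩
      1ℚ * ∣ a - 0ℚ ∣        ≡⟨ *-identityˡ _ ⟩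
      ∣ a - 0ℚ ∣             <⟨ h₂ ⟩
      ½ * δ                  ∎
      where open ≤-Reasoning

  norm<⇒∣∣< : ∀ {a b ε} → 0ℚ ≤ ε → a * a + b * b < ε * ε → ∣ a ∣ < ε × ∣ b ∣ < ε
  norm<⇒∣∣< {a} {b} {ε} 0≤ε h = part a (≤-<-trans left h) , part b (≤-<-trans right h)
    where
    left : a * a ≤ a * a + b * b
    left = subst (_≤ a * a + b * b) (+-identityʳ (a * a)) (+-monoʳ-≤ (a * a) (0≤square b))
    right : b * b ≤ a * a + b * b
    right = subst (_≤ a * a + b * b) (+-identityˡ (b * b)) (+-monoˡ-≤ (b * b) (0≤square a))
    part : ∀ a → a * a < ε * ε → ∣ a ∣ < ε
    part a a²<ε² = ≰⇒> λ ε≤∣a∣ →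
      <-irrefl refl (<-≤-trans a²<ε² (subst (ε * ε ≤_) (∣p∣*∣p∣≡p*p a) (square-mono 0≤ε ε≤∣a∣)))

  ≈-1 : ∀ {z} → (∀ ε → 0ℚ < ε → Eventually (λ n → norm (1ᵍ +ᵍ at z n) < ε * ε)) → z ≈ℂ -ℂ 1ℂ
  ≈-1 {z} h =
    (λ ε 0<ε → eventually-map (λ n k → subst (λ a → ∣ a ∣ < ε) (solve 1 (λ a → con 1ℚ :+ a := a :- (:- (con 1ℚ)))
        refl (seq (re z) n))
      (proj₁ (norm<⇒∣∣< {Re (1ᵍ +ᵍ at z n)} {Im (1ᵍ +ᵍ at z n)} (<⇒≤ 0<ε) k))) (h ε 0<ε)) ,
    (λ ε 0<ε → eventually-map (λ n k → subst (λ a → ∣ a ∣ < ε) (solve 1 (λ a → con 0ℚ :+ a := a :- (:- (con 0ℚ)))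
        refl (seq (im z) n))
      (proj₂ (norm<⇒∣∣< {Re (1ᵍ +ᵍ at z n)} {Im (1ᵍ +ᵍ at z n)} (<⇒≤ 0<ε) k))) (h ε 0<ε))
    where open ℚ-Solver.+-*-Solver

  0<^ : ∀ {r} → 0ℚ < r → ∀ n → 0ℚ < r ^ n
  0<^ 0<r zero    = from-yes (0ℚ <? 1ℚ)
  0<^ 0<r (suc n) = *-pos 0<r (0<^ 0<r n)

  ^≤norm : ∀ {r u} → 0ℚ < r → r ≤ norm u → ∀ n → r ^ n ≤ norm (u ^ᵍ n)
  ^≤norm 0<r r≤ zero    = ≤-reflexive (sym (norm-ι 1ℚ))
  ^≤norm {r} {u} 0<r r≤ (suc n) = subst (r * r ^ n ≤_) (sym (norm-homo-* u (u ^ᵍ n)))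
    (*-mono-≤ (0≤norm u) (<⇒≤ (0<^ 0<r n)) r≤ (^≤norm 0<r r≤ n))

  -- The inverse is the conjugate divided by the norm. Multiplicativity of the norm turns r² ≤ ∣u∣²
  -- into ∣w∣² ≤ η² with η = 1 / r.
  reciprocalᵍ : ∀ {u r η} → 0ℚ ≤ η → 0ℚ < norm u → η * r ≡ 1ℚ → r * r ≤ norm u → ∃[ w ] (u *ᵍ w ≡ 1ᵍ × w ≼ η)
  reciprocalᵍ {u} {r} {η} 0≤η 0<norm ηr≡1 r²≤ with reciprocal (norm u) 0<norm
  ... | θ , _ , normθ≡1 = w , uw≡1 , ≼-intro 0≤η (begin
      norm w                        ≡⟨ sym (*-identityˡ (norm w)) ⟩
      (1ℚ * 1ℚ) * norm w            ≡⟨ cong (λ a → (a * a) * norm w) (sym ηr≡1) ⟩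
      (η * r) * (η * r) * norm w    ≡⟨ solve 3 (λ η r v → (η :* r) :* (η :* r) :* v := (η :* η) :* ((r :* r) :* v))
          refl η r (norm w) ⟩
      (η * η) * ((r * r) * norm w)  ≤⟨ *-monoˡ-≤-nonNeg (η * η) {{nonNegative (0≤square η)}}
                                         (*-monoʳ-≤-nonNeg (norm w) {{nonNegative (0≤norm w)}} r²≤) ⟩
      (η * η) * (norm u * norm w)   ≡⟨ cong ((η * η) *_) (sym (norm-homo-* u w)) ⟩
      (η * η) * norm (u *ᵍ w)       ≡⟨ cong (λ v → (η * η) * norm v) uw≡1 ⟩
      (η * η) * norm 1ᵍ             ≡⟨ *-identityʳ (η * η) ⟩
      η * η                         ∎)
    where
    open ≤-Reasoning
    open ℚ-Solver.+-*-Solver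
    w : ℚ[i]
    w = (Re u * θ) ∔𝕚 (- Im u * θ)
    uw≡1 : u *ᵍ w ≡ 1ᵍ
    uw≡1 = cong₂ _∔𝕚_
      (trans (solve 3 (λ a b θ → a :* (a :* θ) :+ :- (b :* (:- b :* θ)) := (a :* a :+ b :* b) :* θ)
          refl (Re u) (Im u) θ) normθ≡1)
      (solve 3 (λ a b θ → a :* (:- b :* θ) :+ b :* (a :* θ) := con 0ℚ) refl (Re u) (Im u) θ)

  σ⁻¹ : ℚ
  σ⁻¹ = + 19 / 10

  -- Approximations of a root in the excluded regions

  module _ {P} (est : Estimates (evalᵍ P)) (z : ℂ) (root : eval P z ≈ℂ 0ℂ) where
    open Estimates est

    values-vanish : ∀ δ → 0ℚ < δ → Eventually (λ n → norm (evalᵍ P (at z n)) < δ)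
    values-vanish δ 0<δ = eventually-map (λ n → subst (λ u → norm u < δ) (eval-at P z n)) (norm-vanishes {eval P z} root δ 0<δ)

    0<κ² : 0ℚ < κ * κ
    0<κ² = from-yes (0ℚ <? κ * κ)

    0≤κ : 0ℚ ≤ κ
    0≤κ = from-yes (0ℚ ≤? κ)

    κ²≤quotient : ∀ u → norm (1ᵍ +ᵍ u) ≤ ρ * ρ → κ * κ ≤ norm (quotient u)
    κ²≤quotient u y≤ρ² = <⇒≤ (≰⇒> λ quotient≤κ² →
      near u (≼-intro (from-yes (0ℚ ≤? ρ)) y≤ρ²) (≼-intro 0≤κ quotient≤κ²))

    norm-y< : ∀ ε → 0ℚ < ε → ∀ u → norm (1ᵍ +ᵍ u) ≤ ρ * ρ → norm (evalᵍ P u) < ε ^ multiplicity * (κ * κ) →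
      norm (1ᵍ +ᵍ u) < ε
    norm-y< ε 0<ε u y≤ρ² I< = ≰⇒> λ ε≤norm → <-irrefl refl (<-≤-trans I< (begin
      ε ^ multiplicity * (κ * κ)                    ≤⟨ *-mono-≤ (0≤norm ((1ᵍ +ᵍ u) ^ᵍ multiplicity)) (<⇒≤ 0<κ²)
                                                           (^≤norm {ε} {1ᵍ +ᵍ u} 0<ε ε≤norm multiplicity) (κ²≤quotient u y≤ρ²) ⟩
      norm ((1ᵍ +ᵍ u) ^ᵍ multiplicity) * norm (quotient u)  ≡⟨ sym (norm-homo-* ((1ᵍ +ᵍ u) ^ᵍ multiplicity) (quotient u)) ⟩
      norm ((1ᵍ +ᵍ u) ^ᵍ multiplicity *ᵍ quotient u)        ≡⟨ cong norm (sym (factored u)) ⟩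
      norm (evalᵍ P u)                                ∎))
      where open ≤-Reasoning

    -- The quotient is bounded away from 0 in the disc, so the values of the polynomial can tend to
    -- 0 only through the power of y. Given ε, they are made small enough to force ∣y∣² < ε².
    near⇒≈-1 : Eventually (λ n → norm (1ᵍ +ᵍ at z n) ≤ ρ * ρ) → z ≈ℂ -ℂ 1ℂ
    near⇒≈-1 small = ≈-1 {z} λ ε 0<ε →
      eventually-map {λ n → norm (1ᵍ +ᵍ at z n) ≤ ρ * ρ × norm (evalᵍ P (at z n)) < (ε * ε) ^ multiplicity * (κ * κ)}
        (λ n (y≤ρ² , I<) → norm-y< (ε * ε) (*-pos 0<ε 0<ε) (at z n) y≤ρ² I<)
        (eventually-× small (values-vanish ((ε * ε) ^ multiplicity * (κ * κ))
          (*-pos (0<^ (*-pos 0<ε 0<ε) multiplicity) 0<κ²)))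

    not-far : ¬ Eventually (λ n → σ⁻¹ * σ⁻¹ ≤ norm (1ᵍ +ᵍ at z n))
    not-far large = contradictory (proj₁ common) (proj₂ common (proj₁ common) ℕₚ.≤-refl)
      where
      common : Eventually (λ n → σ⁻¹ * σ⁻¹ ≤ norm (1ᵍ +ᵍ at z n) × norm (evalᵍ P (at z n)) < κ * κ)
      common = eventually-× large (values-vanish (κ * κ) 0<κ²)
      contradictory : ∀ n → σ⁻¹ * σ⁻¹ ≤ norm (1ᵍ +ᵍ at z n) × norm (evalᵍ P (at z n)) < κ * κ → ⊥
      contradictory n (y≥ , I<) =
        let w , yw≡1 , w≼σ = reciprocalᵍ {1ᵍ +ᵍ at z n} {σ⁻¹} {σ} (from-yes (0ℚ ≤? σ))
                               (<-≤-trans (from-yes (0ℚ <? σ⁻¹ * σ⁻¹)) y≥) refl y≥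
        in far (at z n) w yw≡1 w≼σ (≼-intro 0≤κ (<⇒≤ I<))

  annulus : ∀ {P} → Estimates (evalᵍ P) → ∀ z → eval P z ≈ℂ 0ℂ → ¬ (z ≈ℂ -ℂ 1ℂ) →
    (fromℚ ½ <ℝ ∣ 1ℂ +ℂ z ∣ℂ) × (∣ 1ℂ +ℂ z ∣ℂ <ℝ fromℚ (+ 2 / 1))
  annulus {P} est z root z≉-1 =
    inner (located X {a₁ * a₁} {ρ * ρ} (from-yes (a₁ * a₁ <? ρ * ρ))) ,
    outer (located X {σ⁻¹ * σ⁻¹} {a₂ * a₂} (from-yes (σ⁻¹ * σ⁻¹ <? a₂ * a₂)))
    where
    X : ℝ
    -- `seq X n` computes to `norm (1ᵍ +ᵍ at z n)`, so the outcomes of `located` fit the rational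
    -- estimates without conversion.
    X = re (1ℂ +ℂ z) *ℝ re (1ℂ +ℂ z) +ℝ im (1ℂ +ℂ z) *ℝ im (1ℂ +ℂ z)
    a₁ a₂ : ℚ
    -- 0.51, below ρ = 0.52 and of the shape c + ε + ε that `<√` expects.
    a₁ = ½ + + 1 / 200 + + 1 / 200
    -- Between 1/σ = 1.9 and 2, leaving the gap 1/20 for `√<`.
    a₂ = + 39 / 20
    inner : Eventually (λ n → a₁ * a₁ ≤ seq X n) ⊎ Eventually (λ n → seq X n ≤ ρ * ρ) → fromℚ ½ <ℝ √ X
    inner (inj₁ large) = <√ X ½ (+ 1 / 200) (from-yes (0ℚ ≤? ½)) (from-yes (0ℚ <? + 1 / 200)) large
    inner (inj₂ small) = ⊥-elim (z≉-1 (near⇒≈-1 {P} est z root small))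
    outer : Eventually (λ n → σ⁻¹ * σ⁻¹ ≤ seq X n) ⊎ Eventually (λ n → seq X n ≤ a₂ * a₂) → √ X <ℝ fromℚ (+ 2 / 1)
    outer (inj₁ large) = ⊥-elim (not-far {P} est z root large)
    outer (inj₂ small) = √< X a₂ (+ 1 / 20) (from-yes (0ℚ ≤? a₂)) (from-yes (0ℚ <? + 1 / 20)) small

open Bounds using (Estimates; Estimates-cong; estimates-generic; estimates-p=2,q=3; annulus)

-- Residue classes modulo p²q

open import Data.Nat using (_+_; _*_; _^_; _≤_; _<_; NonZero; pred; s≤s; z≤n)
open import Data.Nat.Divisibility
open import Data.Nat.DivMod using (_%_; _mod_; m%n<n)
open import Data.Nat.Primality using (Prime; euclidsLemma; prime⇒irreducible; prime⇒nonZero; prime⇒nonTrivial)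
open import Data.Nat.Tactic.RingSolver using (solve-∀)

open Equivalence using (to; from)

-- The wildcard covers the combination p ∤ v, p² ∣ v, which no residue realises; this accounts for
-- the conjunction in `∣p²-classOf`.
classOf : (p∣ p²∣ q∣ : Bool) → Class
classOf false _     false = ⟨1⟩
classOf false _     true  = ⟨q⟩
classOf true  false false = ⟨p⟩
classOf true  false true  = ⟨pq⟩
classOf true  true  false = ⟨p²⟩
classOf true  true  true  = ⟨0⟩

∣p-classOf : ∀ a b c → ∣p (classOf a b c) ≡ a
∣p-classOf false _     false = refl
∣p-classOf false _     true  = refl
∣p-classOf true  false false = refl
∣p-classOf true  false true  = refl
∣p-classOf true  true  false = refl
∣p-classOf true  true  true  = refl

∣p²-classOf : ∀ a b c → ∣p² (classOf a b c) ≡ a ∧ b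
∣p²-classOf false _     false = refl
∣p²-classOf false _     true  = refl
∣p²-classOf true  false false = refl
∣p²-classOf true  false true  = refl
∣p²-classOf true  true  false = refl
∣p²-classOf true  true  true  = refl

∣q-classOf : ∀ a b c → ∣q (classOf a b c) ≡ c
∣q-classOf false _     false = refl
∣q-classOf false _     true  = refl
∣q-classOf true  false false = refl
∣q-classOf true  false true  = refl
∣q-classOf true  true  false = refl
∣q-classOf true  true  true  = refl

∣pq ∣p²q : Class → Bool
∣pq k = ∣p k ∧ ∣q k
∣p²q k = ∣p² k ∧ ∣q k

-- The equation between bits states in one go that R is the union of P and Q and that these are
-- disjoint.
count-split : ∀ {A : Set} (P Q R : A → Bool) → (∀ a → bit (R a) ≡ bit (P a) + bit (Q a)) →
  ∀ f n → count R f n ≡ count P f n + count Q f n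
count-split P Q R h f zero    = refl
count-split P Q R h f (suc n) = trans (cong₂ _+_ (h (f 0)) (count-split P Q R h (f ∘ suc) n))
  (interchange ℕₚ.+-commutativeSemigroup (bit (P (f 0))) (bit (Q (f 0))) (count P (f ∘ suc) n) (count Q (f ∘ suc) n))

count-++ : ∀ {A : Set} (P : A → Bool) f m n → count P f (m + n) ≡ count P f m + count P (f ∘ (m ℕ.+_)) n
count-++ P f zero    n = refl
count-++ P f (suc m) n = trans (cong (bit (P (f 0)) ℕ.+_) (count-++ P (f ∘ suc) m n))
  (sym (ℕₚ.+-assoc (bit (P (f 0))) (count P (f ∘ suc) m) _))

divisible : ℕ → ℕ → Bool
divisible m i = does (m ∣? i)

-- The range splits into k periods of length m, each with exactly one multiple, its first element.
count-multiples : ∀ m .{{_ : NonZero m}} k → count (divisible m) id (k * m) ≡ k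
count-multiples m       zero    = refl
count-multiples m@(suc m-1) (suc k) = trans (count-++ (divisible m) id m (k * m))
  (cong₂ _+_ firstPeriod
    (trans (count-cong (divisible m) (m ℕ.+_) (divisible m) id periodic (k * m)) (count-multiples m k)))
  where
  firstPeriod : count (divisible m) id m ≡ 1
  firstPeriod = cong₂ _+_ (cong bit (dec-true (m ∣? 0) (m ∣0)))
    (count-none (divisible m) suc m-1 λ i i<m-1 → dec-false (m ∣? suc i) (>⇒∤ (s≤s i<m-1)))
  periodic : ∀ i → divisible m (m + i) ≡ divisible m i
  periodic i = does-⇔ (mk⇔ (λ m∣m+i → ∣m+n∣m⇒∣n m∣m+i ∣-refl) (∣m∣n⇒∣m+n ∣-refl)) (m ∣? (m + i)) (m ∣? i)

mod≡0⇔∣ : ∀ n .{{_ : NonZero n}} k → k mod n ≡ 0ₙ n ⇔ n ∣ k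
mod≡0⇔∣ n k = mk⇔
  (λ e → m%n≡0⇒n∣m k n (trans (sym (toℕ-mod k)) (trans (cong toℕ e) toℕ-0ₙ)))
  (λ n∣k → Finₚ.toℕ-injective (trans (toℕ-mod k) (trans (n∣m⇒m%n≡0 k n n∣k) (sym toℕ-0ₙ))))
  where
  toℕ-mod : ∀ j → toℕ (j mod n) ≡ j % n
  toℕ-mod j = Finₚ.toℕ-fromℕ< (m%n<n j n)
  toℕ-0ₙ : toℕ (0ₙ n) ≡ 0
  toℕ-0ₙ = trans (toℕ-mod 0) (n∣m⇒m%n≡0 0 n (n ∣0))

-- The zero divisor graph in terms of classes

module _ {p q : ℕ} (pp : Prime p) (pq : Prime q) (p<q : p < q) where

  private
    instance
      p≢0 : NonZero p
      p≢0 = prime⇒nonZero pp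
      q≢0 : NonZero q
      q≢0 = prime⇒nonZero pq
      n≢0 : NonZero (p ^ 2 * q)
      n≢0 = p²q-nonZero pp pq
    n : ℕ
    n = p ^ 2 * q

  p²≡p*p : p ^ 2 ≡ p * p
  p²≡p*p = cong (p *_) (ℕₚ.*-identityʳ p)

  class : ℕ → Class
  class v = classOf (divisible p v) (divisible (p ^ 2) v) (divisible q v)

  p²∣⇒p∣ : ∀ {v} → p ^ 2 ∣ v → p ∣ v
  p²∣⇒p∣ = ∣-trans (m∣m*n (p * 1))

  q∤p : ¬ q ∣ p
  q∤p = >⇒∤ p<q

  q∤p² : ¬ q ∣ p ^ 2
  q∤p² q∣p² = q∤p (reduce (euclidsLemma p p pq (subst (q ∣_) p²≡p*p q∣p²)))

  ∣∧q∣⇒*∣ : ∀ {d v} → ¬ q ∣ d → d ∣ v → q ∣ v → d * q ∣ v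
  ∣∧q∣⇒*∣ {d} q∤d (divides c refl) q∣v with euclidsLemma c d pq q∣v
  ... | inj₁ q∣c = subst (_∣ c * d) (ℕₚ.*-comm q d) (*-monoˡ-∣ d q∣c)
  ... | inj₂ q∣d = contradiction q∣d q∤d

  T-does : ∀ {A : Set} {b} (a? : Dec A) → b ≡ does a? → T b ⇔ A
  T-does (yes a) refl = mk⇔ (λ _ → a) _
  T-does (no ¬a) refl = mk⇔ (λ ()) ¬a

  T-∣p : ∀ v → T (∣p (class v)) ⇔ p ∣ v
  T-∣p v = T-does (p ∣? v) (∣p-classOf (divisible p v) (divisible (p ^ 2) v) (divisible q v))

  T-∣q : ∀ v → T (∣q (class v)) ⇔ q ∣ v
  T-∣q v = T-does (q ∣? v) (∣q-classOf (divisible p v) (divisible (p ^ 2) v) (divisible q v))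

  T-∣p² : ∀ v → T (∣p² (class v)) ⇔ p ^ 2 ∣ v
  T-∣p² v = T-does (p ^ 2 ∣? v) (trans (∣p²-classOf (divisible p v) (divisible (p ^ 2) v) (divisible q v)) absorb)
    where
    absorb : divisible p v ∧ divisible (p ^ 2) v ≡ divisible (p ^ 2) v
    absorb with p ^ 2 ∣? v
    ... | yes p²∣v = cong (_∧ true) (dec-true (p ∣? v) (p²∣⇒p∣ p²∣v))
    ... | no  _    = ∧-zeroʳ (divisible p v)

  T-∣pq : ∀ v → T (∣pq (class v)) ⇔ p * q ∣ v
  T-∣pq v = mk⇔
    (λ t → let tp , tq = to T-∧ t in ∣∧q∣⇒*∣ q∤p (to (T-∣p v) tp) (to (T-∣q v) tq))
    (λ d → from T-∧ (from (T-∣p v) (m*n∣⇒m∣ p q d) , from (T-∣q v) (m*n∣⇒n∣ p q d)))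

  T-∣p²q : ∀ v → T (∣p²q (class v)) ⇔ n ∣ v
  T-∣p²q v = mk⇔
    (λ t → let tp , tq = to T-∧ t in ∣∧q∣⇒*∣ q∤p² (to (T-∣p² v) tp) (to (T-∣q v) tq))
    (λ d → from T-∧ (from (T-∣p² v) (m*n∣⇒m∣ (p ^ 2) q d) , from (T-∣q v) (m*n∣⇒n∣ (p ^ 2) q d)))

  -- Euclid's lemma twice: it first gives v = w p, and after cancelling p it applies to u w.
  p²∣u*v⇒p²∣v : ∀ u v → ¬ p ∣ u → p ^ 2 ∣ u * v → p ^ 2 ∣ v
  p²∣u*v⇒p²∣v u v p∤u p²∣uv with euclidsLemma u v pp (p²∣⇒p∣ p²∣uv)
  ... | inj₁ p∣u = contradiction p∣u p∤u
  ... | inj₂ (divides w refl) with euclidsLemma u w pp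
          (*-cancelʳ-∣ p (subst₂ _∣_ p²≡p*p (sym (ℕₚ.*-assoc u w p)) p²∣uv))
  ...   | inj₁ p∣u = contradiction p∣u p∤u
  ...   | inj₂ p∣w = subst (_∣ w * p) (sym p²≡p*p) (*-monoˡ-∣ p p∣w)

  p²∣u*v-cases : ∀ u v → p ^ 2 ∣ u * v → p ^ 2 ∣ u ⊎ p ^ 2 ∣ v ⊎ (p ∣ u × p ∣ v)
  p²∣u*v-cases u v p²∣uv with p ∣? u | p ∣? v
  ... | yes p∣u | yes p∣v = inj₂ (inj₂ (p∣u , p∣v))
  ... | no p∤u  | _       = inj₂ (inj₁ (p²∣u*v⇒p²∣v u v p∤u p²∣uv))
  ... | _       | no p∤v  = inj₁ (p²∣u*v⇒p²∣v v u p∤v (subst (p ^ 2 ∣_) (ℕₚ.*-comm u v) p²∣uv))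

  T-annihilates : ∀ u v → T (annihilates (class u) (class v)) ⇔ n ∣ u * v
  T-annihilates u v = mk⇔ sound complete
    where
    sound : T (annihilates (class u) (class v)) → n ∣ u * v
    sound t = let tp , tq = to T-∧ t in ∣∧q∣⇒*∣ q∤p² (p-part (to T-∨ tp)) (q-part (to T-∨ tq))
      where
      q-part : T (∣q (class u)) ⊎ T (∣q (class v)) → q ∣ u * v
      q-part (inj₁ t) = ∣m⇒∣m*n v (to (T-∣q u) t)
      q-part (inj₂ t) = ∣n⇒∣m*n u (to (T-∣q v) t)
      p-part : T (∣p² (class u)) ⊎ T _ → p ^ 2 ∣ u * v
      p-part (inj₁ t) = ∣m⇒∣m*n v (to (T-∣p² u) t)
      p-part (inj₂ t) with to T-∨ t
      ... | inj₁ t′ = ∣n⇒∣m*n u (to (T-∣p² v) t′)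
      ... | inj₂ t′ = let tu , tv = to T-∧ t′ in
        subst (_∣ u * v) (sym p²≡p*p) (*-pres-∣ (to (T-∣p u) tu) (to (T-∣p v) tv))
    complete : n ∣ u * v → T (annihilates (class u) (class v))
    complete d = from T-∧ (from T-∨ p-part , from T-∨ q-part)
      where
      p²∣uv : p ^ 2 ∣ u * v
      p²∣uv = m*n∣⇒m∣ (p ^ 2) q d
      q-part : T (∣q (class u)) ⊎ T (∣q (class v))
      q-part with euclidsLemma u v pq (m*n∣⇒n∣ (p ^ 2) q d)
      ... | inj₁ q∣u = inj₁ (from (T-∣q u) q∣u)
      ... | inj₂ q∣v = inj₂ (from (T-∣q v) q∣v)
      p-part : T (∣p² (class u)) ⊎ T _
      p-part with p²∣u*v-cases u v p²∣uv
      ... | inj₁ p²∣u                = inj₁ (from (T-∣p² u) p²∣u)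
      ... | inj₂ (inj₁ p²∣v)         = inj₂ (from T-∨ (inj₁ (from (T-∣p² v) p²∣v)))
      ... | inj₂ (inj₂ (p∣u , p∣v)) = inj₂ (from T-∨ (inj₂ (from T-∧ (from (T-∣p u) p∣u , from (T-∣p v) p∣v))))

  *ₙ≡0⇔ : ∀ a b → _*ₙ_ n a b ≡ 0ₙ n ⇔ T (annihilates (class (toℕ a)) (class (toℕ b)))
  *ₙ≡0⇔ a b = mk⇔ (from (T-annihilates (toℕ a) (toℕ b)) ∘ to (mod≡0⇔∣ n _))
                  (from (mod≡0⇔∣ n _) ∘ to (T-annihilates (toℕ a) (toℕ b)))

  ≡0⇔ : ∀ (a : Fin n) → a ≡ 0ₙ n ⇔ T (∣p²q (class (toℕ a)))
  ≡0⇔ a = mk⇔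
    (λ { refl → from (T-∣p²q (toℕ (0ₙ n))) (subst (n ∣_) (sym 0≡) (n ∣0)) })
    (λ t → Finₚ.toℕ-injective (trans (below (toℕ a) (Finₚ.toℕ<n a) (to (T-∣p²q (toℕ a)) t)) (sym 0≡)))
    where
    0≡ : toℕ (0ₙ n) ≡ 0
    0≡ = trans (Finₚ.toℕ-fromℕ< (m%n<n 0 n)) (n∣m⇒m%n≡0 0 n (n ∣0))
    below : ∀ m → m < n → n ∣ m → m ≡ 0
    below zero    _   _   = refl
    below (suc m) m<n n∣m = contradiction n∣m (>⇒∤ m<n)

  isVertex⇔ : ∀ (a : Fin n) → NonzeroZeroDivisor n a ⇔ T (isVertex (class (toℕ a)))
  isVertex⇔ a = mk⇔ sound complete
    where
    vertex : ∀ k l → ¬ T (∣p²q k) → ¬ T (∣p²q l) → T (annihilates k l) → T (isVertex k)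
    vertex ⟨0⟩  _ h _ _ = ⊥-elim (h _)
    vertex ⟨p⟩  _ _ _ _ = _
    vertex ⟨q⟩  _ _ _ _ = _
    vertex ⟨p²⟩ _ _ _ _ = _
    vertex ⟨pq⟩ _ _ _ _ = _
    vertex ⟨1⟩  ⟨0⟩ _ h _ = ⊥-elim (h _)
    vertex ⟨1⟩  ⟨1⟩ _ _ ()
    vertex ⟨1⟩  ⟨p⟩ _ _ ()
    vertex ⟨1⟩  ⟨q⟩ _ _ ()
    vertex ⟨1⟩  ⟨p²⟩ _ _ ()
    vertex ⟨1⟩  ⟨pq⟩ _ _ ()
    sound : NonzeroZeroDivisor n a → T (isVertex (class (toℕ a)))
    sound (a≢0 , b , b≢0 , ab≡0) = vertex (class (toℕ a)) (class (toℕ b))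
      (a≢0 ∘ from (≡0⇔ a)) (b≢0 ∘ from (≡0⇔ b)) (to (*ₙ≡0⇔ a b) ab≡0)
    nonzero : ∀ k → T (isVertex k) → ¬ T (∣p²q k)
    nonzero ⟨p⟩ _ ()
    nonzero ⟨q⟩ _ ()
    nonzero ⟨p²⟩ _ ()
    nonzero ⟨pq⟩ _ ()
    cofactor : ∀ k → T (isVertex k) → T (∣p k) ⊎ T (∣q k)
    cofactor ⟨p⟩  _ = inj₁ _
    cofactor ⟨q⟩  _ = inj₂ _
    cofactor ⟨p²⟩ _ = inj₁ _
    cofactor ⟨pq⟩ _ = inj₁ _
    1<q : 1 < q
    1<q = ℕₚ.≤-<-trans (ℕ.>-nonZero⁻¹ p) p<q
    1<p : 1 < p
    1<p = ℕ.nonTrivial⇒n>1 p {{prime⇒nonTrivial pp}}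
    witness : ∀ b → b < n → NonZero b → n ∣ toℕ a * b → ∃[ c ] (c ≢ 0ₙ n × _*ₙ_ n a c ≡ 0ₙ n)
    witness b b<n b≢0 n∣ab = fromℕ< b<n
      , (λ e → contradiction (subst (n ∣_) (Finₚ.toℕ-fromℕ< b<n) (to (T-∣p²q _) (to (≡0⇔ _) e))) (>⇒∤ {{b≢0}} b<n))
      , from (mod≡0⇔∣ n _) (subst (λ c → n ∣ toℕ a * c) (sym (Finₚ.toℕ-fromℕ< b<n)) n∣ab)
    complete : T (isVertex (class (toℕ a))) → NonzeroZeroDivisor n a
    complete t = nonzero _ t ∘ to (≡0⇔ a) , kill (cofactor _ t)
      where
      kill : T (∣p (class (toℕ a))) ⊎ T (∣q (class (toℕ a))) → ∃[ c ] (c ≢ 0ₙ n × _*ₙ_ n a c ≡ 0ₙ n)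
      -- A multiple of p is annihilated by pq, which is below n because 1 < p.
      kill (inj₁ p∣a) = witness (p * q)
        (ℕₚ.*-monoˡ-< q (subst (p <_) (sym p²≡p*p) (ℕₚ.m<m*n p p 1<p))) (ℕₚ.m*n≢0 p q)
        (subst₂ _∣_ (trans (sym (ℕₚ.*-assoc p p q)) (cong (_* q) (sym p²≡p*p))) refl
          (*-pres-∣ (to (T-∣p (toℕ a)) p∣a) (∣-refl {p * q})))
      -- A multiple of q is annihilated by p², which is below n because 1 < q.
      kill (inj₂ q∣a) = witness (p ^ 2)
        (ℕₚ.m<m*n (p ^ 2) q {{ℕₚ.m^n≢0 p 2}} 1<q) (ℕₚ.m^n≢0 p 2)
        (subst (_∣ toℕ a * p ^ 2) (ℕₚ.*-comm q (p ^ 2)) (*-monoˡ-∣ (p ^ 2) (to (T-∣q (toℕ a)) q∣a)))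

  independent⇔ : ∀ S → Independent (zeroDivisorGraph n) S ⇔ ClassIndependent class S
  independent⇔ S = mk⇔
    (λ (V , A) → (λ v v∈S → to (isVertex⇔ v) (V v v∈S))
               , (λ u v u∈S v∈S u≢v t → A u v u∈S v∈S (u≢v , from (*ₙ≡0⇔ u v) t)))
    (λ (V , A) → (λ v v∈S → from (isVertex⇔ v) (V v v∈S))
               , (λ u v u∈S v∈S (u≢v , uv≡0) → A u v u∈S v∈S u≢v (to (*ₙ≡0⇔ u v) uv≡0)))

  count-divisible : ∀ P m .{{_ : NonZero m}} k → (∀ v → T (P (class v)) ⇔ m ∣ v) → k * m ≡ n → count P class n ≡ k
  count-divisible P m k h km≡n = begin
    count P class n                     ≡⟨ cong (count P class) (sym km≡n) ⟩
    count P class (k * m)               ≡⟨ count-cong P class (divisible m) id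
                                             (λ v → does-⇔ (h v) (T? (P (class v))) (m ∣? v)) (k * m) ⟩
    count (divisible m) id (k * m)      ≡⟨ count-multiples m k ⟩
    k                                   ∎
    where open ≡-Reasoning

  -- Only multiples are counted directly; the classes follow as differences, since multiples of p²
  -- and of pq differ from `⟨p²⟩` and `⟨pq⟩` by the residue 0 alone. Writing p and q as successors
  -- keeps truncated subtraction out of the formulas.
  count-classes : ∃[ c ] ∃[ d ] (p ≡ suc d × q ≡ suc c
    × count is⟨p⟩ class n ≡ d * c × count is⟨q⟩ class n ≡ d * suc d
    × count is⟨p²⟩ class n ≡ c × count is⟨pq⟩ class n ≡ d)
  count-classes = c , d , p≡ , q≡ , proj₁ ab , proj₂ ab , refl , refl
    where
    a b c d : ℕ
    a = count is⟨p⟩ class n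
    b = count is⟨q⟩ class n
    c = count is⟨p²⟩ class n
    d = count is⟨pq⟩ class n
    multiples-p : count ∣p class n ≡ p * q
    multiples-p = count-divisible ∣p p (p * q) T-∣p (begin
      p * q * p      ≡⟨ ℕₚ.*-assoc p q p ⟩
      p * (q * p)    ≡⟨ cong (p *_) (ℕₚ.*-comm q p) ⟩
      p * (p * q)    ≡⟨ sym (ℕₚ.*-assoc p p q) ⟩
      p * p * q      ≡⟨ cong (_* q) (sym p²≡p*p) ⟩
      n              ∎)
      where open ≡-Reasoning
    multiples-q : count ∣q class n ≡ p ^ 2
    multiples-q = count-divisible ∣q q (p ^ 2) T-∣q refl
    multiples-p² : count ∣p² class n ≡ q
    multiples-p² = count-divisible ∣p² (p ^ 2) {{ℕₚ.m^n≢0 p 2}} q T-∣p² (ℕₚ.*-comm q (p ^ 2))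
    multiples-pq : count ∣pq class n ≡ p
    multiples-pq = count-divisible ∣pq (p * q) {{ℕₚ.m*n≢0 p q}} p T-∣pq
      (trans (sym (ℕₚ.*-assoc p p q)) (cong (_* q) (sym p²≡p*p)))
    multiples-p²q : count ∣p²q class n ≡ 1
    multiples-p²q = count-divisible ∣p²q n 1 T-∣p²q (ℕₚ.*-identityˡ n)
    p≡ : p ≡ suc d
    p≡ = begin
      p                             ≡⟨ sym multiples-pq ⟩
      count ∣pq class n             ≡⟨ count-split is⟨pq⟩ ∣p²q ∣pq
        (λ { ⟨1⟩ → refl ; ⟨p⟩ → refl ; ⟨q⟩ → refl ; ⟨p²⟩ → refl ; ⟨pq⟩ → refl ; ⟨0⟩ → refl }) class n ⟩
      d + count ∣p²q class n        ≡⟨ cong (d ℕ.+_) multiples-p²q ⟩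
      d + 1                         ≡⟨ ℕₚ.+-comm d 1 ⟩
      suc d                         ∎
      where open ≡-Reasoning
    q≡ : q ≡ suc c
    q≡ = begin
      q                             ≡⟨ sym multiples-p² ⟩
      count ∣p² class n             ≡⟨ count-split is⟨p²⟩ ∣p²q ∣p²
        (λ { ⟨1⟩ → refl ; ⟨p⟩ → refl ; ⟨q⟩ → refl ; ⟨p²⟩ → refl ; ⟨pq⟩ → refl ; ⟨0⟩ → refl }) class n ⟩
      c + count ∣p²q class n        ≡⟨ cong (c ℕ.+_) multiples-p²q ⟩
      c + 1                         ≡⟨ ℕₚ.+-comm c 1 ⟩
      suc c                         ∎
      where open ≡-Reasoning
    p²≡ : p ^ 2 ≡ b + p
    p²≡ = begin
      p ^ 2                         ≡⟨ sym multiples-q ⟩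
      count ∣q class n              ≡⟨ count-split is⟨q⟩ ∣pq ∣q
        (λ { ⟨1⟩ → refl ; ⟨p⟩ → refl ; ⟨q⟩ → refl ; ⟨p²⟩ → refl ; ⟨pq⟩ → refl ; ⟨0⟩ → refl }) class n ⟩
      b + count ∣pq class n         ≡⟨ cong (b ℕ.+_) multiples-pq ⟩
      b + p                         ∎
      where open ≡-Reasoning
    p*q≡ : p * q ≡ a + (d + q)
    p*q≡ = begin
      p * q                         ≡⟨ sym multiples-p ⟩
      count ∣p class n              ≡⟨ count-split is⟨p⟩ is⟨pq⟩∪∣p² ∣p
        (λ { ⟨1⟩ → refl ; ⟨p⟩ → refl ; ⟨q⟩ → refl ; ⟨p²⟩ → refl ; ⟨pq⟩ → refl ; ⟨0⟩ → refl }) class n ⟩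
      a + count is⟨pq⟩∪∣p² class n  ≡⟨ cong (a ℕ.+_) (count-split is⟨pq⟩ ∣p² is⟨pq⟩∪∣p²
        (λ { ⟨1⟩ → refl ; ⟨p⟩ → refl ; ⟨q⟩ → refl ; ⟨p²⟩ → refl ; ⟨pq⟩ → refl ; ⟨0⟩ → refl }) class n) ⟩
      a + (d + count ∣p² class n)   ≡⟨ cong (λ m → a + (d + m)) multiples-p² ⟩
      a + (d + q)                   ∎
      where
      open ≡-Reasoning
      is⟨pq⟩∪∣p² : Class → Bool
      is⟨pq⟩∪∣p² k = is⟨pq⟩ k ∨ ∣p² k
    -- Restated for free variables: the actual counts mention p and q, so their equations cannot be
    -- matched with `refl`.
    arithmetic : ∀ {p q} a b c d → p ≡ suc d → q ≡ suc c → p ^ 2 ≡ b + p → p * q ≡ a + (d + q) →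
      a ≡ d * c × b ≡ d * suc d
    arithmetic a b c d refl refl p²≡ p*q≡ =
      ℕₚ.+-cancelʳ-≡ (d + suc c) a (d * c) (trans (sym p*q≡) (expand d c)) ,
      ℕₚ.+-cancelʳ-≡ (suc d) b (d * suc d) (trans (sym p²≡) (expand′ d))
      where
      expand : ∀ d c → suc d * suc c ≡ d * c + (d + suc c)
      expand = solve-∀
      expand′ : ∀ d → suc d * (suc d * 1) ≡ d * suc d + suc d
      expand′ = solve-∀
    ab : a ≡ d * c × b ≡ d * suc d
    ab = arithmetic a b c d p≡ q≡ p²≡ p*q≡

  evalᵍ-zeroDivisorGraph : ∃[ c ] ∃[ d ] (p ≡ suc d × q ≡ suc c
    × (∀ z → evalᵍ (independencePolynomial (zeroDivisorGraph n)) z ≡ closedForm z (d * c) (d * suc d) c d))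
  evalᵍ-zeroDivisorGraph =
    let c , d , p≡ , q≡ , ea , eb , ec , ed = count-classes in
    c , d , p≡ , q≡ , λ z →
      trans (evalᵍ-classified z (zeroDivisorGraph n) class independent⇔) (closedForm-cong z ea eb ec ed)

-- Case distinction on the gap between the primes

even-prime : ∀ {p} → Prime p → 2 ∣ p → p ≡ 2
even-prime pp 2∣p with prime⇒irreducible pp 2∣p
... | inj₂ 2≡p = sym 2≡p

even-or-odd : ∀ m → 2 ∣ m ⊎ 2 ∣ suc m
even-or-odd zero = inj₁ (2 ∣0)
even-or-odd (suc m) with even-or-odd m
... | inj₁ 2∣m  = inj₂ (∣m∣n⇒∣m+n ∣-refl 2∣m)
... | inj₂ 2∣1+m = inj₁ 2∣1+m

-- With j = q - p - 1 one has e = dj. For j = 0 one of two consecutive primes is even, which leaves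
-- (2, 3). For j = 1 the value p = 2 is impossible, so e = d ≥ 2. For j ≥ 2 again e ≥ 2. In the last
-- two cases c = p + j ≥ 4, whence 4d ≤ dc = a.
estimates-primes : ∀ {c d} → Prime (suc d) → Prime (suc c) → suc d < suc c →
  Estimates (λ z → closedForm z (d * c) (d * suc d) c d)
estimates-primes {c} {zero} () _ _
estimates-primes {c} {d@(suc k)} pp pq p<q with ℕₚ.m≤n⇒∃[o]m+o≡n (ℕₚ.≤-pred p<q)
... | j , refl = byGap j pq
  where
  generic : ∀ j → 2 ≤ d * j → 4 ≤ suc d + j →
    Estimates (λ z → closedForm z (d * (suc d + j)) (d * suc d) (suc d + j) d)
  generic j 2≤e 4≤c = Estimates-cong
    (λ z → cong (λ a → closedForm z a (d * suc d) (suc d + j) d) a≡e+b)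
    (estimates-generic (d * j) (d * suc d) (suc d + j) k 2≤e
      (ℕₚ.*-mono-≤ {1} {d} {2} {suc d} (s≤s z≤n) (s≤s (s≤s z≤n)))
      (ℕₚ.≤-trans (s≤s (s≤s z≤n)) 4≤c)
      (ℕₚ.≤-trans (ℕₚ.*-monoʳ-≤ d 4≤c) (ℕₚ.≤-reflexive a≡e+b)))
    where
    a≡e+b : d * (suc d + j) ≡ d * j + d * suc d
    a≡e+b = trans (ℕₚ.*-distribˡ-+ d (suc d) j) (ℕₚ.+-comm (d * suc d) (d * j))
  consecutive : Prime (suc (suc d + 0)) → k ≡ 0
  consecutive pq′ with even-or-odd (suc d)
  ... | inj₁ 2∣p = cong (λ m → pred (pred m)) (even-prime pp 2∣p)
  ... | inj₂ 2∣q with even-prime pq′ (subst (λ m → 2 ∣ suc m) (sym (ℕₚ.+-identityʳ (suc d))) 2∣q)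
  ...   | ()
  byGap : ∀ j → Prime (suc (suc d + j)) →
    Estimates (λ z → closedForm z (d * (suc d + j)) (d * suc d) (suc d + j) d)
  byGap zero pq′ with consecutive pq′
  ... | refl = estimates-p=2,q=3
  byGap 1 pq′ = generic 1
    (ℕₚ.≤-trans (s≤s (0<k k pq′)) (ℕₚ.≤-reflexive (sym (ℕₚ.*-identityʳ d))))
    (ℕₚ.+-monoˡ-≤ 1 (s≤s (s≤s (0<k k pq′))))
    where
    0<k : ∀ k → Prime (suc (suc (suc k) + 1)) → 1 ≤ k
    0<k (suc k) _   = s≤s z≤n
    -- Here p = 2 and q would be 4.
    0<k zero    pr4 with even-prime pr4 (divides 2 refl)
    ... | ()
  byGap j@(suc (suc _)) _ = generic j
    (ℕₚ.*-mono-≤ {1} {d} {2} {j} (s≤s z≤n) (s≤s (s≤s z≤n)))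
    (ℕₚ.+-mono-≤ {2} {suc d} {2} {j} (s≤s (s≤s z≤n)) (s≤s (s≤s z≤n)))

-- With `p`, `q` and `I` as variables the two successor equations can be matched, although the
-- intended `I` is built from a graph on p²q residues.
estimates-closed : ∀ {p q I} → Prime p → Prime q → p < q →
  ∃[ c ] ∃[ d ] (p ≡ suc d × q ≡ suc c × (∀ z → I z ≡ closedForm z (d * c) (d * suc d) c d)) → Estimates I
estimates-closed pp pq p<q (c , d , refl , refl , I≗closed) = Estimates-cong I≗closed (estimates-primes pp pq p<q)

theorem3p3 : (p q : ℕ) (pp : Prime p) (pq : Prime q) → p < q →
    (z : ℂ) →
    eval (independencePolynomial (zeroDivisorGraph (p ^ 2 * q) {{p²q-nonZero pp pq}})) z ≈ℂ 0ℂ →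
    ¬ (z ≈ℂ -ℂ 1ℂ) →
    (fromℚ ½ <ℝ ∣ 1ℂ +ℂ z ∣ℂ) × (∣ 1ℂ +ℂ z ∣ℂ <ℝ fromℚ (+ 2 / 1))
theorem3p3 p q pp pq p<q =
  annulus {independencePolynomial (zeroDivisorGraph (p ^ 2 * q) {{p²q-nonZero pp pq}})}
    (estimates-closed pp pq p<q (evalᵍ-zeroDivisorGraph pp pq p<q))
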